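{- Let $q=p^f$ be a prime power and $N>2$ an integer with $N\mid(q-1)$. Let $\gamma$ be a primitive element of $\mathbb{F}_q$, $C_i=\gamma^i\langle\gamma^N\rangle$ for $0\le i\le N-1$, and $\eta_a=\sum_{x\in C_a}\psi(x)$. Assume that $-1\in C_0$ and that the $\eta_a$, $0\le a\le N-1$, take exactly three rational values $\alpha_1,\alpha_2,\alpha_3$ with $\alpha_1-\alpha_2=-tu<0$ and $\alpha_3-\alpha_2=tv>0$, $t>0$. For $i=1,2,3$ let $I_i=\{a\in\mathbb{Z}_N:\eta_a=\alpha_i\}$, and set $R_0=\{0\}$, $R_i=\bigcup_{j\in I_i}C_j$ for $i=1,2,3$. For $0\le i\le 3$ define $\mathcal{R}_i=\{(x,y)\in\mathbb{F}_q\times\mathbb{F}_q: x-y\in R_i\}$. If $|I_1|=1$ or $|I_3|=1$, then $(\mathbb{F}_q,\{\mathcal{R}_i\}_{i=0}^3)$ is a self-dual three-class association scheme.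
   Context: $\psi$ is the canonical additive character of $\mathbb{F}_q$: $\psi(x)=\xi_p^{\mathrm{Tr}_{q/p}(x)}$. A (symmetric) association scheme with $d$ classes on a finite set $X$ is a partition of $X\times X$ into $R_0,\dots,R_d$ with $R_0$ the diagonal, each $R_i$ symmetric, and such that for all $i,j,k$ the number of $z$ with $(x,z)\in R_i$, $(z,y)\in R_j$ depends only on $i,j,k$ for $(x,y)\in R_k$. If $X$ is an abelian group and $R_i=\{(x,x+y):y\in D_i\}$ for a partition $D_0=\{0\},D_1,\dots,D_d$ of $X$, the scheme is a translation scheme; its dual is the translation scheme on the character group $\widehat X$ whose classes $D_0',\dots,D_d'$ are the equivalence classes of $\chi\sim\chi'$ iff $\chi(D_i)=\chi'(D_i)$ for all $i$. The scheme is self-dual if it is isomorphic to its dual. -}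

module Defs where

open import Algebra.Apartness.Bundles using (HeytingField; HeytingCommutativeRing)
open import Algebra.Bundles using (AbelianGroup; CommutativeRing; Semiring; Monoid)
import Algebra.Definitions.RawSemiring as RawSemiringDefs
open import Algebra.Morphism.Structures using (module MonoidMorphisms)
import Algebra.Properties.AbelianGroup as AbelianGroupProperties
import Algebra.Properties.CommutativeSemigroup as CommutativeSemigroupProperties
open import Data.Fin.Base using (Fin; zero; suc; toℕ)
open import Data.Fin.Permutation using (Permutation; _⟨$⟩ʳ_)
open import Data.Fin.Properties using (any?) renaming (_≟_ to _≟ᶠ_)
open import Data.Integer.Base using (ℤ; +_; -[1+_])
open import Data.List.Base as List using (List; allFin; filter; foldr; length)
open import Data.Nat.Base using (ℕ; zero; suc; _<_) renaming (_^_ to _^ℕ_)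
open import Data.Product.Base using (∃; _×_; _,_; proj₁; uncurry)
open import Data.Product using (∃!)
open import Data.Product.Relation.Binary.Pointwise.NonDependent using (_×ₛ_)
open import Data.Rational.Base using (ℚ; ↥_)
open import Function.Base using (_∘_)
open import Function.Bundles using (Inverse; _⇔_)
open import Function.Properties.Inverse using (Inverse⇒Injection)
open import Function.Construct.Symmetry using () renaming (inverse to inverse-sym)
open import Level using (Level; _⊔_; Lift) renaming (suc to lsuc)
open import Relation.Binary.Bundles using (Setoid)
open import Relation.Binary.Core using (Rel)
import Relation.Binary.Definitions as Binary
open import Relation.Binary.PropositionalEquality as ≡ using (_≡_)
import Relation.Binary.Reasoning.Setoid as SetoidReasoning
open import Relation.Nullary.Decidable using (yes; no; map′; _×-dec_; via-injection)
open import Relation.Unary using (Pred; Decidable)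

private
  variable
    a b ℓ ℓ₁ ℓ₂ ℓ₃ ℓ₄ r s : Level
    d n : ℕ

Enumeration : ℕ → Setoid a ℓ → Set (a ⊔ ℓ)
Enumeration n S = Inverse (≡.setoid (Fin n)) S

Finite : Setoid a ℓ → Set (a ⊔ ℓ)
Finite S = ∃ λ n → Enumeration n S

module _ {S : Setoid a ℓ} (finite : Finite S) where
  open Setoid S

  elements : List Carrier
  elements = let n , e = finite in List.map (Inverse.to e) (allFin n)

  select : {P : Pred Carrier r} → Decidable P → List Carrier
  select P? = filter P? elements

  count : {P : Pred Carrier r} → Decidable P → ℕ
  count P? = length (select P?)

  finite⇒≟ : Binary.Decidable _≈_
  finite⇒≟ = let n , e = finite in
    via-injection (Inverse⇒Injection (inverse-sym e)) _≟ᶠ_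

record IsPartition (S : Setoid a ℓ) (P : Fin n → Pred (Setoid.Carrier S) r)
                   : Set (a ⊔ ℓ ⊔ r) where
  open Setoid S
  field
    respects  : ∀ i {x y} → x ≈ y → P i x → P i y
    inhabited : ∀ i → ∃ (P i)
    classify  : ∀ x → ∃! _≡_ (λ i → P i x)

  class? : ∀ i → Decidable (P i)
  class? i x with j , Pjx , unique ← classify x =
    map′ (λ { ≡.refl → Pjx }) unique (j ≟ᶠ i)

record IsAssociationScheme (X : Setoid a ℓ)
                           (R : Fin (suc d) → Rel (Setoid.Carrier X) r)
                           : Set (a ⊔ ℓ ⊔ r) where
  open Setoid X using (Carrier; _≈_)
  field
    finite      : Finite X
    isPartition : IsPartition (X ×ₛ X) (λ i → uncurry (R i))
    diagonal    : ∀ x y → R zero x y ⇔ x ≈ y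
    symmetric   : ∀ i {x y} → R i x y → R i y x

  R? : ∀ i → Binary.Decidable (R i)
  R? i x y = IsPartition.class? isPartition i (x , y)

  field
    intersectionNumber : (i j k : Fin (suc d)) → ℕ
    regular : ∀ i j k {x y} → R k x y →
      count finite (λ z → R? i x z ×-dec R? j z y) ≡ intersectionNumber i j k

-- An isomorphism may renumber the classes.
record Isomorphism (X : Setoid a ℓ₁) (Y : Setoid b ℓ₂)
                   (R : Fin (suc d) → Rel (Setoid.Carrier X) r)
                   (S : Fin (suc d) → Rel (Setoid.Carrier Y) s)
                   : Set (a ⊔ b ⊔ ℓ₁ ⊔ ℓ₂ ⊔ r ⊔ s) where
  field
    points  : Inverse X Y
    classes : Permutation (suc d) (suc d)
    preserves : ∀ i x y →
      R i x y ⇔ S (classes ⟨$⟩ʳ i) (Inverse.to points x) (Inverse.to points y)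

module _ (X : AbelianGroup a ℓ) where
  open AbelianGroup X

  Translate : (Fin (suc d) → Pred Carrier r) → Fin (suc d) → Rel Carrier (a ⊔ ℓ ⊔ r)
  Translate D i x z = ∃ λ y → D i y × z ≈ x ∙ y

  record IsTranslationScheme (D : Fin (suc d) → Pred Carrier r)
                             (R : Fin (suc d) → Rel Carrier s)
                             : Set (a ⊔ ℓ ⊔ r ⊔ s) where
    field
      isPartition         : IsPartition setoid D
      identity            : ∀ x → D zero x ⇔ x ≈ ε
      translation         : ∀ i x y → R i x y ⇔ Translate D i x y
      isAssociationScheme : IsAssociationScheme setoid R

    open IsPartition isPartition public using () renaming (class? to D?)
    open IsAssociationScheme isAssociationScheme public using (finite)

-- The library has no complex numbers.  Characters and character sums take
-- values in an arbitrary Heyting field of characteristic zero with a primitive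
-- p-th root of unity, of which ℂ is an instance.

module FieldOps (K : HeytingField a ℓ₁ ℓ₂) where
  open HeytingField K public
    hiding (setoid)

  commutativeRing : CommutativeRing a ℓ₁
  commutativeRing = HeytingCommutativeRing.commutativeRing heytingCommutativeRing

  open CommutativeRing commutativeRing public
    using (setoid; semiring; *-monoid; *-commutativeMonoid; +-abelianGroup)

  open RawSemiringDefs (Semiring.rawSemiring semiring) public
    using (_^_; sum) renaming (_×_ to _·_)

  fromℤ : ℤ → Carrier
  fromℤ (+ n)    = n · 1#
  fromℤ -[1+ n ] = - (suc n · 1#)

  sumList : List Carrier → Carrier
  sumList = foldr _+_ 0#

CharacteristicZero : HeytingField a ℓ₁ ℓ₂ → Set ℓ₂
CharacteristicZero K = ∀ n → (suc n · 1#) # 0#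
  where open FieldOps K

fromℚ : (K : HeytingField a ℓ₁ ℓ₂) → CharacteristicZero K →
        ℚ → HeytingField.Carrier K
fromℚ K char0 x = fromℤ (↥ x) * proj₁ (#⇒invertible (char0 (ℚ.denominator-1 x)))
  where open FieldOps K

IsPrimitiveRootOfUnity : (K : HeytingField a ℓ₁ ℓ₂) → ℕ → HeytingField.Carrier K →
                         Set (ℓ₁ ⊔ ℓ₂)
IsPrimitiveRootOfUnity K n ξ = ξ ^ n ≈ 1# × (∀ k → 0 < k → k < n → (ξ ^ k) # 1#)
  where open FieldOps K

IsPrimitiveElement : (F : HeytingField a ℓ₁ ℓ₂) → HeytingField.Carrier F →
                     Set (a ⊔ ℓ₁ ⊔ ℓ₂)
IsPrimitiveElement F γ = γ # 0# × (∀ x → x # 0# → ∃ λ k → x ≈ γ ^ k)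
  where open FieldOps F

module _ (X : AbelianGroup a ℓ) (K : HeytingField b ℓ₁ ℓ₂) where
  private
    module X = AbelianGroup X
    open FieldOps K
    open MonoidMorphisms X.rawMonoid (Monoid.rawMonoid *-monoid)
      using (IsMonoidHomomorphism)

  -- The values are units: χ x has inverse χ (x ⁻¹).
  record Character : Set (a ⊔ ℓ ⊔ b ⊔ ℓ₁) where
    field
      ⟦_⟧                  : X.Carrier → Carrier
      isMonoidHomomorphism : IsMonoidHomomorphism ⟦_⟧

    open IsMonoidHomomorphism isMonoidHomomorphism public

  open Character using (⟦_⟧)

  private
    open CommutativeSemigroupProperties
      (CommutativeRing.*-commutativeSemigroup commutativeRing) using (interchange)
    open SetoidReasoning setoid

    mkCharacter : (χ : X.Carrier → Carrier) →
                  (∀ {x y} → x X.≈ y → χ x ≈ χ y) →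
                  (∀ x y → χ (x X.∙ y) ≈ χ x * χ y) →
                  χ X.ε ≈ 1# → Character
    mkCharacter χ cong homo ε-homo = record
      { ⟦_⟧ = χ
      ; isMonoidHomomorphism = record
        { isMagmaHomomorphism = record
          { isRelHomomorphism = record { cong = cong }
          ; homo = homo
          }
        ; ε-homo = ε-homo
        }
      }

    _⊗_ : Character → Character → Character
    χ ⊗ χ′ = mkCharacter (λ x → ⟦ χ ⟧ x * ⟦ χ′ ⟧ x)
      (λ x≈y → *-cong (χ.⟦⟧-cong x≈y) (χ′.⟦⟧-cong x≈y))
      (λ x y → trans (*-cong (χ.homo x y) (χ′.homo x y)) (interchange _ _ _ _))
      (trans (*-cong χ.ε-homo χ′.ε-homo) (*-identityˡ 1#))
      where module χ = Character χ
            module χ′ = Character χ′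

    trivial : Character
    trivial = mkCharacter (λ _ → 1#) (λ _ → refl) (λ _ _ → sym (*-identityˡ 1#)) refl

    conjugate : Character → Character
    conjugate χ = mkCharacter (λ x → ⟦ χ ⟧ (x X.⁻¹))
      (χ.⟦⟧-cong ∘ X.⁻¹-cong)
      (λ x y → trans (χ.⟦⟧-cong (X.sym (AbelianGroupProperties.⁻¹-∙-comm X x y)))
                     (χ.homo (x X.⁻¹) (y X.⁻¹)))
      (trans (χ.⟦⟧-cong (AbelianGroupProperties.ε⁻¹≈ε X)) χ.ε-homo)
      where module χ = Character χ

    conjugateˡ : ∀ χ x → ⟦ χ ⟧ (x X.⁻¹) * ⟦ χ ⟧ x ≈ 1#
    conjugateˡ χ x = begin
      ⟦ χ ⟧ (x X.⁻¹) * ⟦ χ ⟧ x  ≈⟨ χ.homo (x X.⁻¹) x ⟨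
      ⟦ χ ⟧ (x X.⁻¹ X.∙ x)      ≈⟨ χ.⟦⟧-cong (X.inverseˡ x) ⟩
      ⟦ χ ⟧ X.ε                 ≈⟨ χ.ε-homo ⟩
      1#                        ∎
      where module χ = Character χ

  characterGroup : AbelianGroup (a ⊔ ℓ ⊔ b ⊔ ℓ₁) (a ⊔ ℓ₁)
  characterGroup = record
    { Carrier = Character
    ; _≈_ = λ χ χ′ → ∀ x → ⟦ χ ⟧ x ≈ ⟦ χ′ ⟧ x
    ; _∙_ = _⊗_
    ; ε   = trivial
    ; _⁻¹ = conjugate
    ; isAbelianGroup = record
      { isGroup = record
        { isMonoid = record
          { isSemigroup = record
            { isMagma = record
              { isEquivalence = record
                { refl  = λ _ → refl
                ; sym   = λ χ≈χ′ x → sym (χ≈χ′ x)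
                ; trans = λ χ≈χ′ χ′≈χ″ x → trans (χ≈χ′ x) (χ′≈χ″ x)
                }
              ; ∙-cong = λ χ≈χ′ φ≈φ′ x → *-cong (χ≈χ′ x) (φ≈φ′ x)
              }
            ; assoc = λ _ _ _ _ → *-assoc _ _ _
            }
          ; identity = (λ _ _ → *-identityˡ _) , (λ _ _ → *-identityʳ _)
          }
        ; inverse = conjugateˡ , (λ χ x → trans (*-comm _ _) (conjugateˡ χ x))
        ; ⁻¹-cong = λ χ≈χ′ x → χ≈χ′ (x X.⁻¹)
        }
      ; comm = λ _ _ _ → *-comm _ _
      }
    }

module _ {X : AbelianGroup a ℓ} (K : HeytingField b ℓ₁ ℓ₂)
         {D : Fin (suc d) → Pred (AbelianGroup.Carrier X) r}
         {R : Fin (suc d) → Rel (AbelianGroup.Carrier X) s}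
         (scheme : IsTranslationScheme X D R) where
  private
    X̂ = characterGroup X K
    module X = AbelianGroup X
    module X̂ = AbelianGroup X̂
    module scheme = IsTranslationScheme scheme
    open FieldOps K

  characterSum : X̂.Carrier → Fin (suc d) → Carrier
  characterSum χ i =
    sumList (List.map (Character.⟦_⟧ χ) (select scheme.finite (scheme.D? i)))

  _∼_ : Rel X̂.Carrier ℓ₁
  χ ∼ χ′ = ∀ i → characterSum χ i ≈ characterSum χ′ i

  -- D′ enumerates the equivalence classes of _∼_, each exactly once.
  record IsDualPartition (D′ : Fin (suc d) → Pred X̂.Carrier ℓ₁)
                         : Set (a ⊔ ℓ ⊔ b ⊔ ℓ₁) where
    field
      isPartition : IsPartition X̂.setoid D′
      isClass     : ∀ i {χ} → D′ i χ → ∀ χ′ → D′ i χ′ ⇔ χ ∼ χ′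

  record IsSelfDual : Set (a ⊔ ℓ ⊔ b ⊔ lsuc ℓ₁ ⊔ s) where
    field
      D′              : Fin (suc d) → Pred X̂.Carrier ℓ₁
      isDualPartition : IsDualPartition D′
      dualScheme      : IsTranslationScheme X̂ D′ (Translate X̂ D′)
      isomorphism     : Isomorphism X.setoid X̂.setoid R (Translate X̂ D′)

module Cyclotomy
  (F : HeytingField a ℓ₁ ℓ₂) {q : ℕ} (enum : Enumeration q (FieldOps.setoid F))
  (K : HeytingField b ℓ₃ ℓ₄) (char0 : CharacteristicZero K)
  (p f : ℕ) (ξ : HeytingField.Carrier K)
  (γ : HeytingField.Carrier F) (N : ℕ)
  where
  private
    module F = FieldOps F
    module K = FieldOps K
    open F using (_≈_; _^_; _·_; 1#; 0#)

    _≟_ : Binary.Decidable _≈_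
    _≟_ = finite⇒≟ (q , enum)

  Tr : F.Carrier → F.Carrier
  Tr x = F.sum {f} (λ j → x ^ (p ^ℕ toℕ j))

  -- The n < p with n · 1 = Tr x.  When q = p ^ f is the order of F, the trace
  -- lies in the prime field and the second clause is never reached.
  residue : F.Carrier → ℕ
  residue x with any? {n = p} (λ n → (toℕ n · 1#) ≟ Tr x)
  ... | yes (n , _) = toℕ n
  ... | no _        = 0

  ψ : F.Carrier → K.Carrier
  ψ x = ξ K.^ residue x

  -- The exponents below q already exhaust ⟨γ ^ N⟩, whose order is at most q ∸ 1.
  C : ℕ → Pred F.Carrier ℓ₁
  C i x = ∃ λ (k : Fin q) → x ≈ γ ^ i F.* (γ ^ N) ^ toℕ k

  C? : ∀ i → Decidable (C i)
  C? i x = any? λ k → x ≟ (γ ^ i F.* (γ ^ N) ^ toℕ k)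

  η : Fin N → K.Carrier
  η j = K.sumList (List.map ψ (select (q , enum) (C? (toℕ j))))

  -- Below, α 0F, α 1F, α 2F are α₁, α₂, α₃, and likewise for I.
  module _ (α : Fin 3 → ℚ) where

    I : Fin 3 → Pred (Fin N) ℓ₃
    I i j = η j K.≈ fromℚ K char0 (α i)

    PeriodsTakeExactlyTheValues : Set ℓ₃
    PeriodsTakeExactlyTheValues = (∀ j → ∃ λ i → I i j) × (∀ i → ∃ λ j → I i j)

    R : Fin 4 → Pred F.Carrier (ℓ₁ ⊔ ℓ₃)
    R zero    x = Lift ℓ₃ (x ≈ 0#)
    R (suc i) x = ∃ λ j → I i j × C (toℕ j) x

    𝓡 : Fin 4 → Rel F.Carrier (ℓ₁ ⊔ ℓ₃)
    𝓡 i x y = R i (x F.- y)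

{-# OPTIONS --safe #-}
module Submission where

-- Let C_c be the class that makes up R₁ (or R₃).  The character sum of R₁ at ψ(y ·) is
-- then the single period η(γ^c y).  The sums of R₁, R₂, R₃ add up to −1 for y ≠ 0, and
-- since −1 ∈ C₀ the sum weighted by the α's is q [y ∈ C₀] − |C₀|.  As the α's are distinct,
-- these two equations determine the remaining two sums, so all the sums depend only on the
-- class of γ^c y and the dual classes are { ψ(y ·) : γ^c y ∈ R_i }.  A partition with this
-- property has constant intersection numbers, by Fourier inversion of the convolution of
-- two classes, and x ↦ ψ(γ^-c x ·) carries it onto the dual scheme.
--
-- Equality in K is not decidable, but it is stable by tightness, which is enough for all
-- equations; ψ is nontrivial because the periods take different values.

open import Defs
open import Algebra.Apartness.Bundles using (HeytingField)
open import Algebra.Bundles using (AbelianGroup; CommutativeMonoid; CommutativeRing)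
import Algebra.Apartness.Properties.HeytingCommutativeRing as HeytingRingProperties
import Algebra.Properties.AbelianGroup as AbelianGroupProperties
import Algebra.Properties.CommutativeMonoid.Mult as CommutativeMonoidMult
import Algebra.Properties.CommutativeMonoid.Sum as CommutativeMonoidSum
import Algebra.Properties.CommutativeSemiring.Binomial as Binomial
import Algebra.Properties.CommutativeSemiring.Exp as Exp
import Algebra.Properties.Ring as RingProperties
import Algebra.Properties.Semiring.Mult as Mult
import Algebra.Properties.Semiring.Sum as SemiringSum
import Algebra.Solver.Ring.NaturalCoefficients.Default as SemiringSolver
open import Data.Bool.Base using (if_then_else_)
open import Data.Empty using (⊥; ⊥-elim)
open import Data.Fin.Base as Fin using (Fin; toℕ; fromℕ<; punchIn)
open import Data.Fin.Patterns using (0F; 1F; 2F)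
import Data.Fin.Permutation as Permutation
import Data.Fin.Properties as Fin
open import Data.Integer.Base as ℤ using (ℤ; +_; -[1+_])
import Data.Integer.Properties as ℤ
open import Data.List.Base as List using (List; []; _∷_)
open import Data.Nat.Base as ℕ using (ℕ; zero; suc; _∸_; _<_; _≤_; s≤s; z≤n; NonZero)
open import Data.Nat.Combinatorics using (_C_; nCn≡1; nCk≡n!/k![n-k]!; k![n∸k]!∣n!)
open import Data.Nat.Coprimality using (coprime-Bézout; prime⇒coprime)
open import Data.Nat.Divisibility using (_∣_; divides; m∣m*n; n∣m*n; m%n≡0⇒n∣m; ∣1⇒≡1; ∣⇒≤)
open import Data.Nat.DivMod using (m/n*n≡m; _%_; _/_; m≡m%n+[m/n]*n; m%n<n)
import Data.Nat.Properties as ℕ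
open import Data.Nat.GCD using (module Bézout)
open import Data.Nat.Primality using (Prime; ¬prime[1]; euclidsLemma; prime⇒nonZero; prime⇒nonTrivial)
open import Data.Product using (Σ; ∃; _×_; _,_; proj₁; proj₂; ∃!)
open import Data.Product.Base using (uncurry)
open import Data.Product.Relation.Binary.Pointwise.NonDependent using (_×ₛ_)
open import Data.Rational.Base as ℚ using (ℚ; 0ℚ)
import Data.Rational.Properties as ℚ
open import Data.Sum.Base using (_⊎_; inj₁; inj₂)
open import Function.Base using (_∘_; id; case_of_)
open import Function.Bundles using (Inverse; _⇔_; mk⇔; Equivalence)
import Function.Construct.Composition as Composition
import Function.Construct.Symmetry as Symmetry
open import Level using (Level; Lift; lift)
open import Relation.Binary.Bundles using (Setoid)
open import Relation.Binary.Core using (Rel)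
open import Relation.Binary.PropositionalEquality as ≡ using (_≡_; _≢_)
import Relation.Binary.Reasoning.Setoid as SetoidReasoning
open import Relation.Nullary using (¬_; Dec; yes; no; does)
open import Relation.Nullary.Decidable using (_×-dec_; ¬?; decidable-stable)
open import Relation.Unary using (Pred; Decidable)

-- The mechanism is a double Fourier transform. The period x ↦ Σ ψ(x y), summed over y in C₀, is the
-- transform of the indicator of C₀, and R₁, R₂, R₃ are its level sets away from 0. Transforming
-- once more returns q times the indicator of C₀ at -y, and -1 ∈ C₀ removes the sign; the value |C₀|
-- of the period at 0 accounts for the term -|C₀|. A singleton I₁ or I₃ makes one level set a coset
-- of C₀, so its transform is again a period, with a shifted argument. This supplies the missing
-- third equation for three unknown sums, and the shift γ^c is the only discrepancy between the
-- partition and its dual. The character group of F does not come with an enumeration, so duality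
-- has to produce, for each character, the field element that represents it. Wherever a search or a
-- case distinction is made, it is about F, ℕ or a finite index, where equality is decidable, or it
-- comes from cotransitivity of apartness in K.

private
  variable
    a b ℓ ℓ₁ ℓ₂ ℓ₃ ℓ₄ r s : Level
    m n d : ℕ

-- Heyting fields and finite sums

module HeytingFieldProperties (K : HeytingField a ℓ₁ ℓ₂) where
  open FieldOps K hiding (zero)
  open HeytingRingProperties (HeytingField.heytingCommutativeRing K) public
    using (x-0≈x; 1#0; #-congʳ; invertibleˡ⇒#)
  open RingProperties (CommutativeRing.ring commutativeRing) public
    using (-0#≈0#; -‿distribˡ-*; -‿distribʳ-*; -‿+-comm; -‿involutive; -1*x≈-x;
           x∙y⁻¹≈ε⇒x≈y; x≈y⇒x∙y⁻¹≈ε; +-cancelˡ; +-cancelʳ; +-inverseˡ-unique; [y-z]x≈yx-zx)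
  open Mult semiring public hiding (_×_)
  open Exp (CommutativeRing.commutativeSemiring commutativeRing) public
    using (^-congˡ; ^-congʳ; ^-homo-*; ^-assocʳ)
  open SetoidReasoning setoid

  module Solver = SemiringSolver (CommutativeRing.commutativeSemiring commutativeRing)

  #⇒≉ : ∀ {x y} → x # y → ¬ x ≈ y
  #⇒≉ x#y x≈y = proj₂ (tight _ _) x≈y x#y

  ≉⇒¬¬# : ∀ {x y} → ¬ x ≈ y → ¬ ¬ x # y
  ≉⇒¬¬# x≉y ¬x#y = x≉y (proj₁ (tight _ _) ¬x#y)

  ≈-stable : ∀ {x y} → ¬ ¬ x ≈ y → x ≈ y
  ≈-stable ¬¬x≈y = proj₁ (tight _ _) λ x#y → ¬¬x≈y (#⇒≉ x#y)

  inverse : ∀ {x} → x # 0# → ∃ λ x⁻¹ → x⁻¹ * x ≈ 1#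
  inverse x#0 with x⁻¹ , eq , _ ← #⇒invertible x#0 =
    x⁻¹ , trans (*-congˡ (sym (x-0≈x _))) eq

  invertible⇒#0 : ∀ {x y} → y * x ≈ 1# → x # 0#
  invertible⇒#0 {x} {y} eq = invertibleˡ⇒# (y , trans (*-congˡ (x-0≈x x)) eq)

  *-cancel-inverse : ∀ {x y} → y * x ≈ 1# → ∀ z → y * (x * z) ≈ z
  *-cancel-inverse inv z = trans (sym (*-assoc _ _ _)) (trans (*-congʳ inv) (*-identityˡ z))

  *-cancelˡ-# : ∀ {x y z} → x # 0# → x * y ≈ x * z → y ≈ z
  *-cancelˡ-# {x} {y} {z} x#0 eq with x⁻¹ , inv ← inverse x#0 = begin
    y               ≈⟨ *-cancel-inverse inv y ⟨
    x⁻¹ * (x * y)   ≈⟨ *-congˡ eq ⟩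
    x⁻¹ * (x * z)   ≈⟨ *-cancel-inverse inv z ⟩
    z               ∎

  -- No inverse can be extracted from a mere inequality, but the conclusion is stable, so the
  -- inverse may be used under a double negation.
  *-cancelˡ : ∀ {x y z} → ¬ x ≈ 0# → x * y ≈ x * z → y ≈ z
  *-cancelˡ x≉0 eq = ≈-stable λ y≉z → ≉⇒¬¬# x≉0 λ x#0 → y≉z (*-cancelˡ-# x#0 eq)

  *-≉0 : ∀ {x y} → ¬ x ≈ 0# → ¬ y ≈ 0# → ¬ x * y ≈ 0#
  *-≉0 x≉0 y≉0 xy≈0 = y≉0 (*-cancelˡ x≉0 (trans xy≈0 (sym (zeroʳ _))))

  ^-≉0 : ∀ {x} n → ¬ x ≈ 0# → ¬ x ^ n ≈ 0#
  ^-≉0 zero    x≉0 = #⇒≉ 1#0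
  ^-≉0 (suc n) x≉0 = *-≉0 x≉0 (^-≉0 n x≉0)

  1^ : ∀ n → 1# ^ n ≈ 1#
  1^ zero    = refl
  1^ (suc n) = trans (*-identityˡ _) (1^ n)

  indicator : ∀ {P : Set r} → Dec P → Carrier
  indicator P? = if does P? then 1# else 0#

  indicator-yes : ∀ {P : Set r} (P? : Dec P) → P → indicator P? ≈ 1#
  indicator-yes (yes _) _ = refl
  indicator-yes (no ¬p) p = ⊥-elim (¬p p)

  indicator-no : ∀ {P : Set r} (P? : Dec P) → ¬ P → indicator P? ≈ 0#
  indicator-no (no _)  _  = refl
  indicator-no (yes p) ¬p = ⊥-elim (¬p p)

  indicator-⇔ : ∀ {P : Set r} {Q : Set s} (P? : Dec P) (Q? : Dec Q) →
                (P → Q) → (Q → P) → indicator P? ≈ indicator Q?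
  indicator-⇔ (yes p) Q? f g = sym (indicator-yes Q? (f p))
  indicator-⇔ (no ¬p) Q? f g = sym (indicator-no Q? (¬p ∘ g))

  indicator-× : ∀ {P : Set r} {Q : Set s} (P? : Dec P) (Q? : Dec Q) →
                indicator (P? ×-dec Q?) ≈ indicator P? * indicator Q?
  indicator-× (yes _) (yes _) = sym (*-identityˡ _)
  indicator-× (yes _) (no _)  = sym (*-identityˡ _)
  indicator-× (no _)  _       = sym (zeroˡ _)

  -- Cotransitivity compares the sum with its tail: either the tail is apart from 0, or the sum is
  -- apart from the tail and the difference, which is the head, is invertible. This replaces a
  -- search for a nonzero term, which undecidable equality would not allow.
  sum-#0 : ∀ {n} (t : Fin n → Carrier) → sum t # 0# → ∃ λ i → t i # 0#
  sum-#0 {zero}  t 0#0 = ⊥-elim (#⇒≉ 0#0 refl)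
  sum-#0 {suc n} t s#0 with #-cotrans s#0 (sum (t ∘ Fin.suc))
  ... | inj₂ tail#0 = let i , tᵢ#0 = sum-#0 (t ∘ Fin.suc) tail#0 in Fin.suc i , tᵢ#0
  ... | inj₁ s#tail with u , _ , inv ← #⇒invertible s#tail = Fin.zero , invertible⇒#0 (begin
    u * t Fin.zero                                          ≈⟨ *-congˡ (cancel _ _) ⟨
    u * (t Fin.zero + sum (t ∘ Fin.suc) - sum (t ∘ Fin.suc))  ≈⟨ *-comm _ _ ⟩
    (t Fin.zero + sum (t ∘ Fin.suc) - sum (t ∘ Fin.suc)) * u  ≈⟨ inv ⟩
    1#                                                      ∎)
    where
    cancel : ∀ x y → x + y - y ≈ x
    cancel x y = trans (+-assoc _ _ _) (trans (+-congˡ (-‿inverseʳ y)) (+-identityʳ x))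

module _ (M : CommutativeMonoid a ℓ) where
  open CommutativeMonoid M
  open CommutativeMonoidSum M using (sum; sum-remove; sum-permute; sum-cong-≋; sum-replicate; sum-replicate-zero; ∑-distrib-+)
  open CommutativeMonoidMult M using () renaming (_×_ to _·_)
  open SetoidReasoning setoid

  sum-single : ∀ {n} (t : Fin n → Carrier) i → (∀ j → j ≢ i → t j ≈ ε) → sum t ≈ t i
  sum-single {suc n} t i rest = begin
    sum t                          ≈⟨ sum-remove t ⟩
    t i ∙ sum (t ∘ punchIn i)      ≈⟨ ∙-congˡ (sum-cong-≋ λ j → rest _ (Fin.punchInᵢ≢i i j)) ⟩
    t i ∙ sum {n} (λ _ → ε)        ≈⟨ ∙-congˡ (sum-replicate-zero n) ⟩
    t i ∙ ε                        ≈⟨ identityʳ _ ⟩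
    t i                            ∎

  -- Written for a commutative monoid so that sums over F and the product over F share one
  -- development.
  module SumOver {S : Setoid b ℓ₁} (e : Enumeration n S) where
    private
      module S = Setoid S
      module e = Inverse e

    opaque
      ∑ : (S.Carrier → Carrier) → Carrier
      ∑ g = sum (g ∘ e.to)

      ∑-cong : ∀ {g h} → (∀ x → g x ≈ h x) → ∑ g ≈ ∑ h
      ∑-cong g≈h = sum-cong-≋ {n} (g≈h ∘ e.to)

      ∑-distrib-∙ : ∀ g h → ∑ (λ x → g x ∙ h x) ≈ ∑ g ∙ ∑ h
      ∑-distrib-∙ g h = ∑-distrib-+ {n} (g ∘ e.to) (h ∘ e.to)

      ∑-const : ∀ k → ∑ (λ _ → k) ≈ n · k
      ∑-const k = sum-replicate n

      ∑-induction : (P : Pred Carrier r) → P ε → (∀ {x y} → P x → P y → P (x ∙ y)) →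
                    ∀ {g} → (∀ x → P (g x)) → P (∑ g)
      ∑-induction P Pε P∙ {g} Pg = helper (g ∘ e.to) (Pg ∘ e.to)
        where
        helper : ∀ {m} (t : Fin m → Carrier) → (∀ i → P (t i)) → P (sum t)
        helper {zero}  t Pt = Pε
        helper {suc m} t Pt = P∙ (Pt Fin.zero) (helper (t ∘ Fin.suc) (Pt ∘ Fin.suc))

      -- Conjugating π by the enumeration gives a permutation of the indices. The round trip through
      -- an index returns an element only up to `≈`, hence the condition on `g`.
      ∑-permute : (π : Inverse S S) (g : S.Carrier → Carrier) → (∀ {x y} → x S.≈ y → g x ≈ g y) →
                  ∑ (g ∘ Inverse.to π) ≈ ∑ g
      ∑-permute π g g-cong = sym (trans (sum-permute (g ∘ e.to) σ)
                                        (sum-cong-≋ {n} λ i → g-cong (e.strictlyInverseˡ (Inverse.to π (e.to i)))))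
        where
        σ : Permutation.Permutation n n
        σ = Composition.inverse e (Composition.inverse π (Symmetry.inverse e))

      ∑-single : ∀ g x → (∀ {x y} → x S.≈ y → g x ≈ g y) → (∀ y → ¬ y S.≈ x → g y ≈ ε) → ∑ g ≈ g x
      ∑-single g x g-cong rest = trans
        (sum-single (g ∘ e.to) (e.from x) λ j j≢ → rest _ λ to-j≈x →
          j≢ (≡.trans (≡.sym (e.strictlyInverseʳ j)) (e.from-cong to-j≈x)))
        (g-cong (e.strictlyInverseˡ x))

module FiniteSums (K : HeytingField a ℓ₁ ℓ₂) {S : Setoid b ℓ₃} (e : Enumeration n S) where
  open FieldOps K hiding (zero)
  open HeytingFieldProperties K
  private
    module S = Setoid S
    module e = Inverse e
    module Sum = SemiringSum semiring

  open SumOver (CommutativeRing.+-commutativeMonoid commutativeRing) e public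
    renaming (∑-distrib-∙ to ∑-distrib-+)
  open SetoidReasoning setoid

  opaque
    unfolding ∑

    *-distribˡ-∑ : ∀ k g → k * ∑ g ≈ ∑ (λ x → k * g x)
    *-distribˡ-∑ k g = Sum.*-distribˡ-sum {n} k (g ∘ e.to)

    *-distribʳ-∑ : ∀ k g → ∑ g * k ≈ ∑ (λ x → g x * k)
    *-distribʳ-∑ k g = Sum.*-distribʳ-sum {n} k (g ∘ e.to)

    ∑-comm : ∀ (g : S.Carrier → S.Carrier → Carrier) → ∑ (λ x → ∑ (g x)) ≈ ∑ (λ y → ∑ (λ x → g x y))
    ∑-comm g = Sum.∑-comm {n} {n} (λ i j → g (e.to i) (e.to j))

    ∑-sum-comm : ∀ {m} (g : S.Carrier → Fin m → Carrier) →
                 ∑ (λ x → sum (g x)) ≈ sum (λ i → ∑ (λ x → g x i))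
    ∑-sum-comm {m} g = Sum.∑-comm {n} {m} (λ i j → g (e.to i) j)

    ∑-#0 : ∀ {g} → ∑ g # 0# → ∃ λ x → g x # 0#
    ∑-#0 {g} ∑#0 = let i , gᵢ#0 = sum-#0 (g ∘ e.to) ∑#0 in e.to i , gᵢ#0

  module _ {P : Pred S.Carrier r} (P? : Decidable P) where

    opaque
      unfolding ∑

      sumList-select : ∀ g → sumList (List.map g (select (n , e) P?)) ≈
                             ∑ (λ x → indicator (P? x) * g x)
      sumList-select g = helper id
        where
        -- `allFin n` is `tabulate id`; the induction needs an arbitrary `f` in place of `id`.
        helper : ∀ {m} (f : Fin m → Fin n) →
          sumList (List.map g (List.filter P? (List.map e.to (List.tabulate f)))) ≈
          sum (λ i → indicator (P? (e.to (f i))) * g (e.to (f i)))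
        helper {zero}  f = refl
        helper {suc m} f with P? (e.to (f Fin.zero))
        ... | yes _ = +-cong (sym (*-identityˡ _)) (helper (f ∘ Fin.suc))
        ... | no  _ = trans (helper (f ∘ Fin.suc)) (sym (trans (+-congʳ (zeroˡ _)) (+-identityˡ _)))

    count-select : count (n , e) P? · 1# ≈ ∑ (λ x → indicator (P? x))
    count-select = begin
      count (n , e) P? · 1#                                    ≈⟨ helper (select (n , e) P?) ⟩
      sumList (List.map (λ _ → 1#) (select (n , e) P?))        ≈⟨ sumList-select (λ _ → 1#) ⟩
      ∑ (λ x → indicator (P? x) * 1#)                          ≈⟨ ∑-cong (λ _ → *-identityʳ _) ⟩
      ∑ (λ x → indicator (P? x))                               ∎
      where
      helper : ∀ (xs : List S.Carrier) → List.length xs · 1# ≈ sumList (List.map (λ _ → 1#) xs)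
      helper []       = refl
      helper (x ∷ xs) = +-congˡ (helper xs)

-- Finite fields and the trace

prime∤! : ∀ {p} → Prime p → ∀ k → k < p → ¬ p ∣ k ℕ.!
prime∤! p-prime zero    _   p∣1 = ¬prime[1] (≡.subst Prime (∣1⇒≡1 p∣1) p-prime)
prime∤! p-prime (suc k) k<p p∣k! with euclidsLemma (suc k) (k ℕ.!) p-prime p∣k!
... | inj₁ p∣1+k = ℕ.<⇒≱ k<p (∣⇒≤ p∣1+k)
... | inj₂ p∣k!′ = prime∤! p-prime k (ℕ.<-trans (ℕ.n<1+n k) k<p) p∣k!′

-- p divides p! = (p C k) · k! (p - k)!, but neither of the two factorials of numbers below p.
prime∣C : ∀ {p} → Prime p → ∀ k → 0 < k → k < p → p ∣ p C k
prime∣C {p@(suc p-1)} p-prime k 0<k k<p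
  with euclidsLemma (p C k) (k ℕ.! ℕ.* (p ∸ k) ℕ.!) p-prime p∣C*d
  where
  instance _ = ℕ._!*_!≢0 k (p ∸ k)
  p! : p ℕ.! ≡ (p C k) ℕ.* (k ℕ.! ℕ.* (p ∸ k) ℕ.!)
  p! = ≡.trans (≡.sym (m/n*n≡m (k![n∸k]!∣n! (ℕ.<⇒≤ k<p))))
               (≡.cong (ℕ._* (k ℕ.! ℕ.* (p ∸ k) ℕ.!)) (≡.sym (nCk≡n!/k![n-k]! (ℕ.<⇒≤ k<p))))
  p∣C*d : p ∣ (p C k) ℕ.* (k ℕ.! ℕ.* (p ∸ k) ℕ.!)
  p∣C*d = ≡.subst (p ∣_) p! (m∣m*n (p-1 ℕ.!))
... | inj₁ p∣C = p∣C
... | inj₂ p∣d with euclidsLemma (k ℕ.!) ((p ∸ k) ℕ.!) p-prime p∣d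
...   | inj₁ p∣k!   = ⊥-elim (prime∤! p-prime k k<p p∣k!)
...   | inj₂ p∣p-k! = ⊥-elim (prime∤! p-prime (p ∸ k) (ℕ.∸-monoʳ-< 0<k (ℕ.<⇒≤ k<p)) p∣p-k!)

module FiniteField (F : HeytingField a ℓ₁ ℓ₂) {q : ℕ} (enum : Enumeration q (FieldOps.setoid F)) where
  open FieldOps F hiding (zero)
  open HeytingFieldProperties F
  open SetoidReasoning setoid
  private
    module e = Inverse enum
    module ∏ = SumOver *-commutativeMonoid enum
  open FiniteSums F enum

  infix 4 _≟_
  _≟_ : ∀ x y → Dec (x ≈ y)
  _≟_ = finite⇒≟ (q , enum)

  dilation : ∀ {x} → x # 0# → Inverse setoid setoid
  dilation {x} x#0 with x⁻¹ , inv ← inverse x#0 = record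
    { to = x *_
    ; from = x⁻¹ *_
    ; to-cong = *-congˡ
    ; from-cong = *-congˡ
    ; inverse = (λ eq → trans (*-congˡ eq) (*-cancel-inverse (trans (*-comm _ _) inv) _))
              , (λ eq → trans (*-congˡ eq) (*-cancel-inverse inv _))
    }

  translation : Carrier → Inverse setoid setoid
  translation x = record
    { to = _+ x
    ; from = _- x
    ; to-cong = +-congʳ
    ; from-cong = +-congʳ
    ; inverse = (λ eq → trans (+-congʳ eq) (trans (+-assoc _ _ _)
                          (trans (+-congˡ (-‿inverseˡ x)) (+-identityʳ _))))
              , (λ eq → trans (+-congʳ eq) (trans (+-assoc _ _ _)
                          (trans (+-congˡ (-‿inverseʳ x)) (+-identityʳ _))))
    }

  negation : Inverse setoid setoid
  negation = record
    { to = -_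
    ; from = -_
    ; to-cong = -‿cong
    ; from-cong = -‿cong
    ; inverse = (λ eq → trans (-‿cong eq) (-‿involutive _))
              , (λ eq → trans (-‿cong eq) (-‿involutive _))
    }

  -- Adding 1 permutes F, so the sum of all elements is unchanged when q · 1 is added to it.
  q·1≈0 : q · 1# ≈ 0#
  q·1≈0 = +-cancelˡ (∑ id) _ _ (begin
    ∑ id + q · 1#          ≈⟨ +-congˡ (∑-const 1#) ⟨
    ∑ id + ∑ (λ _ → 1#)    ≈⟨ ∑-distrib-+ id (λ _ → 1#) ⟨
    ∑ (λ x → x + 1#)       ≈⟨ ∑-permute (translation 1#) id id ⟩
    ∑ id                   ≈⟨ +-identityʳ _ ⟨
    ∑ id + 0#              ∎)

  private
    choose : ∀ {P : Set r} → Dec P → Carrier → Carrier → Carrier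
    choose P? y z = if does P? then y else z

    choose-yes : ∀ {P : Set r} (P? : Dec P) {y z} → P → choose P? y z ≈ y
    choose-yes (yes _) _ = refl
    choose-yes (no ¬p) p = ⊥-elim (¬p p)

    choose-no : ∀ {P : Set r} (P? : Dec P) {y z} → ¬ P → choose P? y z ≈ z
    choose-no (no _)  _  = refl
    choose-no (yes p) ¬p = ⊥-elim (¬p p)

    choose-cong : ∀ {P : Set r} {Q : Set s} (P? : Dec P) (Q? : Dec Q) {y z z′} →
                  (P → Q) → (Q → P) → z ≈ z′ → choose P? y z ≈ choose Q? y z′
    choose-cong (yes p) Q? f g z≈z′ = sym (choose-yes Q? (f p))
    choose-cong (no ¬p) Q? f g z≈z′ = trans z≈z′ (sym (choose-no Q? (¬p ∘ g)))

  -- Multiplication by x permutes the nonzero elements and so preserves their product.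
  x^q≈x-# : ∀ {x} → x # 0# → x ^ q ≈ x
  x^q≈x-# {x} x#0 = sym (*-cancelˡ ∏≉0 (begin
    ∏.∑ h * x                            ≈⟨ *-cong (∏.∑-permute (dilation x#0) h h-cong) ∏δ ⟨
    ∏.∑ (λ y → h (x * y)) * ∏.∑ δ        ≈⟨ ∏.∑-distrib-∙ _ _ ⟨
    ∏.∑ (λ y → h (x * y) * δ y)          ≈⟨ ∏.∑-cong pointwise ⟩
    ∏.∑ (λ y → h y * x)                  ≈⟨ ∏.∑-distrib-∙ _ _ ⟩
    ∏.∑ h * ∏.∑ (λ _ → x)                ≈⟨ *-congˡ (∏.∑-const x) ⟩
    ∏.∑ h * x ^ q                        ∎))
    where
    -- `h` replaces 0 by 1, so its product runs over the nonzero elements. At y = 0 the factor `δ`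
    -- supplies the x that `h (x * y)` lacks; hence the exponent is q and not q - 1, and no sum over
    -- a subset is needed.
    h δ : Carrier → Carrier
    h y = choose (y ≟ 0#) 1# y
    δ y = choose (y ≟ 0#) x 1#

    h-cong : ∀ {y z} → y ≈ z → h y ≈ h z
    h-cong y≈z = choose-cong (_ ≟ 0#) (_ ≟ 0#) (trans (sym y≈z)) (trans y≈z) y≈z

    ∏δ : ∏.∑ δ ≈ x
    ∏δ = trans
      (∏.∑-single δ 0#
        (λ y≈z → choose-cong (_ ≟ 0#) (_ ≟ 0#) (trans (sym y≈z)) (trans y≈z) refl)
        (λ y → choose-no (y ≟ 0#)))
      (choose-yes (0# ≟ 0#) refl)

    pointwise : ∀ y → h (x * y) * δ y ≈ h y * x
    pointwise y = case y ≟ 0# of λ where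
      (yes y≈0) → *-cong
        (trans (choose-yes (_ ≟ 0#) (trans (*-congˡ y≈0) (zeroʳ x))) (sym (choose-yes (y ≟ 0#) y≈0)))
        (choose-yes (y ≟ 0#) y≈0)
      (no y≉0) → begin
        h (x * y) * δ y  ≈⟨ *-cong (choose-no (_ ≟ 0#) (*-≉0 (#⇒≉ x#0) y≉0)) (choose-no (y ≟ 0#) y≉0) ⟩
        (x * y) * 1#     ≈⟨ *-identityʳ _ ⟩
        x * y            ≈⟨ *-comm x y ⟩
        y * x            ≈⟨ *-congʳ (choose-no (y ≟ 0#) y≉0) ⟨
        h y * x          ∎

    h≉0 : ∀ y → ¬ h y ≈ 0#
    h≉0 y = case y ≟ 0# of λ where
      (yes y≈0) hy≈0 → #⇒≉ 1#0 (trans (sym (choose-yes (y ≟ 0#) y≈0)) hy≈0)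
      (no y≉0)  hy≈0 → y≉0 (trans (sym (choose-no (y ≟ 0#) y≉0)) hy≈0)

    ∏≉0 : ¬ ∏.∑ h ≈ 0#
    ∏≉0 = ∏.∑-induction (λ y → ¬ y ≈ 0#) (#⇒≉ 1#0) *-≉0 h≉0

  0<q : 0 < q
  0<q = ℕ.≤-<-trans z≤n (Fin.toℕ<n (e.from 0#))

  1<q : 1 < q
  1<q = helper _ (e.from 0#) (e.from 1#)
      (λ eq → #⇒≉ 1#0 (trans (sym (e.strictlyInverseˡ 1#))
        (trans (e.to-cong (≡.sym eq)) (e.strictlyInverseˡ 0#))))
    where
    helper : ∀ n (i j : Fin n) → i ≢ j → 1 < n
    helper (suc zero)    0F 0F i≢j = ⊥-elim (i≢j ≡.refl)
    helper (suc (suc n)) _  _  _   = s≤s (s≤s z≤n)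

  x^q≈x : ∀ x → x ^ q ≈ x
  x^q≈x x with x ≟ 0#
  ... | no x≉0  = ≈-stable λ neq → ≉⇒¬¬# x≉0 (neq ∘ x^q≈x-#)
  ... | yes x≈0 = trans (^-congˡ q x≈0) (trans (0^ 0<q) (sym x≈0))
    where
    0^ : ∀ {n} → 0 < n → 0# ^ n ≈ 0#
    0^ {suc n} _ = zeroˡ _

  x^[q-1]≈1 : ∀ {x} → ¬ x ≈ 0# → x ^ (q ∸ 1) ≈ 1#
  x^[q-1]≈1 {x} x≉0 = *-cancelˡ x≉0 (begin
    x * x ^ (q ∸ 1)  ≈⟨ ^-congʳ x (ℕ.m+[n∸m]≡n 0<q) ⟩
    x ^ q            ≈⟨ x^q≈x x ⟩
    x                ≈⟨ *-identityʳ x ⟨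
    x * 1#           ∎)

  -- The power x^(q - 2) is an explicit inverse. From here on the decidable inequality of F yields
  -- apartness outright.
  ≉0⇒#0 : ∀ {x} → ¬ x ≈ 0# → x # 0#
  ≉0⇒#0 {x} x≉0 = invertible⇒#0 (begin
    x ^ (q ∸ 2) * x  ≈⟨ *-comm _ _ ⟩
    x * x ^ (q ∸ 2)  ≈⟨ ^-congʳ x (≡.sym (ℕ.+-∸-assoc 1 1<q)) ⟩
    x ^ (q ∸ 1)      ≈⟨ x^[q-1]≈1 x≉0 ⟩
    1#               ∎)

-- Monic polynomial functions and the number of their roots

module Polynomials (F : HeytingField a ℓ₁ ℓ₂) where
  open FieldOps F hiding (zero)
  open HeytingFieldProperties F
  open SetoidReasoning setoid
  open Solver using (solve; _:+_; _:*_; _:=_)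

  -- Horner form: the constant coefficient is split off at each step, and the innermost factor is
  -- the leading coefficient 1.
  Monic : ℕ → (Carrier → Carrier) → Set _
  Monic zero    f = Lift a (∀ x → f x ≈ 1#)
  Monic (suc n) f = ∃ λ c → ∃ λ g → Monic n g × (∀ x → f x ≈ c + x * g x)

  Monic-^ : ∀ n → Monic n (_^ n)
  Monic-^ zero    = lift λ _ → refl
  Monic-^ (suc n) = 0# , (_^ n) , Monic-^ n , λ x → sym (+-identityˡ _)

  Monic-+ : ∀ n {f g} → Monic (suc n) f → Monic n g → ∀ k → Monic (suc n) (λ x → f x + k * g x)
  Monic-+ zero {f} {g} (c , h , hm , f≈) (lift g≈1) k = c + k , h , hm , λ x → begin
    f x + k * g x         ≈⟨ +-cong (f≈ x) (trans (*-congˡ (g≈1 x)) (*-identityʳ k)) ⟩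
    (c + x * h x) + k     ≈⟨ solve 3 (λ c y k → (c :+ y) :+ k := (c :+ k) :+ y) refl c (x * h x) k ⟩
    (c + k) + x * h x     ∎
  Monic-+ (suc n) {f} {g} (c , h , hm , f≈) (c′ , h′ , hm′ , g≈) k =
    c + k * c′ , _ , Monic-+ n hm hm′ k , λ x → begin
    f x + k * g x                                   ≈⟨ +-cong (f≈ x) (*-congˡ (g≈ x)) ⟩
    (c + x * h x) + k * (c′ + x * h′ x)             ≈⟨ solve 6 (λ c c′ x h h′ k →
        (c :+ x :* h) :+ k :* (c′ :+ x :* h′) := (c :+ k :* c′) :+ x :* (h :+ k :* h′))
        refl c c′ x (h x) (h′ x) k ⟩
    (c + k * c′) + x * (h x + k * h′ x)             ∎

  -- f x − f y = (x − y) g x, with both sides moved so that no subtraction occurs.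
  divide : ∀ n {f} → Monic (suc n) f → ∀ y →
           ∃ λ g → Monic n g × (∀ x → f x + y * g x ≈ f y + x * g x)
  divide zero {f} (c , h , lift h≈1 , f≈) y = h , lift h≈1 , λ x → begin
    f x + y * h x              ≈⟨ +-congʳ (f≈ x) ⟩
    (c + x * h x) + y * h x    ≈⟨ solve 3 (λ c u v → (c :+ u) :+ v := (c :+ v) :+ u)
                                    refl c (x * h x) (y * h x) ⟩
    (c + y * h x) + x * h x    ≈⟨ +-congʳ (+-congˡ (*-congˡ (trans (h≈1 x) (sym (h≈1 y))))) ⟩
    (c + y * h y) + x * h x    ≈⟨ +-congʳ (f≈ y) ⟨
    f y + x * h x              ∎
  divide (suc n) {f} (c , h , hm , f≈) y with k , km , h≈ ← divide n hm y =
    g , Monic-+ n hm km y , λ x → begin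
    f x + y * g x                           ≈⟨ +-cong (f≈ x) (*-congˡ (h≈ x)) ⟩
    (c + x * h x) + y * (h y + x * k x)     ≈⟨ solve 6 (λ c x y hx hy kx →
        (c :+ x :* hx) :+ y :* (hy :+ x :* kx) := (c :+ y :* hy) :+ x :* (hx :+ y :* kx))
        refl c x y (h x) (h y) (k x) ⟩
    (c + y * h y) + x * g x                 ≈⟨ +-congʳ (f≈ y) ⟨
    f y + x * g x                           ∎
    where
    -- With `k` the quotient of `h` by x - y, the difference x h(x) - y h(y) equals (x - y) h(x) + y
    -- (h(x) - h(y)), which is (x - y) (h(x) + y k(x)).
    g : Carrier → Carrier
    g x = h x + y * k x

  -- Divide by the first root: each remaining point differs from it and is therefore a root of the
  -- quotient, whose degree is one less.
  Monic-roots : ∀ n {f} → Monic n f → (root : Fin (suc n) → Carrier) →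
                (∀ {i j} → root i ≈ root j → i ≡ j) → ¬ (∀ i → f (root i) ≈ 0#)
  Monic-roots zero    (lift f≈1) root inj f≈0 = #⇒≉ 1#0 (trans (sym (f≈1 _)) (f≈0 Fin.zero))
  Monic-roots (suc n) {f} fm root inj f≈0
    with g , gm , f≈ ← divide n fm (root Fin.zero) =
    Monic-roots n gm (root ∘ Fin.suc) (Fin.suc-injective ∘ inj) λ i →
      ≈-stable λ g≉0 → Fin.0≢1+n (inj (*-cancelˡ g≉0 (begin
        g (root (Fin.suc i)) * root Fin.zero     ≈⟨ *-comm _ _ ⟩
        root Fin.zero * g (root (Fin.suc i))     ≈⟨ +-identityˡ _ ⟨
        0# + root Fin.zero * g (root (Fin.suc i)) ≈⟨ +-congʳ (f≈0 (Fin.suc i)) ⟨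
        f (root (Fin.suc i)) + root Fin.zero * g (root (Fin.suc i))
          ≈⟨ f≈ (root (Fin.suc i)) ⟩
        f (root Fin.zero) + root (Fin.suc i) * g (root (Fin.suc i))
          ≈⟨ +-congʳ (f≈0 Fin.zero) ⟩
        0# + root (Fin.suc i) * g (root (Fin.suc i)) ≈⟨ +-identityˡ _ ⟩
        root (Fin.suc i) * g (root (Fin.suc i))  ≈⟨ *-comm _ _ ⟩
        g (root (Fin.suc i)) * root (Fin.suc i)  ∎)))

-- Characteristic, Frobenius map and trace

module PrimePowerField (F : HeytingField a ℓ₁ ℓ₂) {q : ℕ} (enum : Enumeration q (FieldOps.setoid F))
                       {p f : ℕ} (p-prime : Prime p) (q≡p^f : q ≡ p ℕ.^ f) where
  open FieldOps F hiding (zero)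
  open HeytingFieldProperties F
  open FiniteField F enum
  open Polynomials F
  open SetoidReasoning setoid
  private
    module Sum = SemiringSum semiring
    module Bin = Binomial (CommutativeRing.commutativeSemiring commutativeRing)
    instance
      p≢0 : NonZero p
      p≢0 = prime⇒nonZero p-prime

  [m^n]·1≈[m·1]^n : ∀ m n → (m ℕ.^ n) · 1# ≈ (m · 1#) ^ n
  [m^n]·1≈[m·1]^n m zero    = ×-homo-1 1#
  [m^n]·1≈[m·1]^n m (suc n) = trans (×1-homo-* m (m ℕ.^ n)) (*-congˡ ([m^n]·1≈[m·1]^n m n))

  -- The f-th power of p · 1 is q · 1 = 0, and a field has no nonzero nilpotent element.
  p·1≈0 : p · 1# ≈ 0#
  p·1≈0 = ≈-stable λ p·1≉0 → ^-≉0 f p·1≉0 (begin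
    (p · 1#) ^ f      ≈⟨ [m^n]·1≈[m·1]^n p f ⟨
    (p ℕ.^ f) · 1#    ≈⟨ ×-congˡ q≡p^f ⟨
    q · 1#            ≈⟨ q·1≈0 ⟩
    0#                ∎)

  p∣⇒·≈0 : ∀ {n} → p ∣ n → ∀ x → n · x ≈ 0#
  p∣⇒·≈0 {n} (divides k ≡.refl) x = begin
    (k ℕ.* p) · x              ≈⟨ ×-congʳ (k ℕ.* p) (*-identityˡ x) ⟨
    (k ℕ.* p) · (1# * x)       ≈⟨ ×-assoc-* (k ℕ.* p) 1# x ⟨
    ((k ℕ.* p) · 1#) * x       ≈⟨ *-congʳ (×1-homo-* k p) ⟩
    ((k · 1#) * (p · 1#)) * x  ≈⟨ *-congʳ (trans (*-congˡ p·1≈0) (zeroʳ _)) ⟩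
    0# * x                     ≈⟨ zeroˡ x ⟩
    0#                         ∎

  1+m*n·1≈1 : ∀ m n → n · 1# ≈ 0# → (1 ℕ.+ m ℕ.* n) · 1# ≈ 1#
  1+m*n·1≈1 m n n·1≈0 = trans (+-congˡ (trans (×1-homo-* m n) (trans (*-congˡ n·1≈0) (zeroʳ _))))
                              (+-identityʳ 1#)

  -- The remainder of n modulo p annihilates 1 as well; if it were nonzero, it would be coprime to p
  -- and Bézout would give 1 = 0.
  ·1≈0⇒p∣ : ∀ {n} → n · 1# ≈ 0# → p ∣ n
  ·1≈0⇒p∣ {n} n·1≈0 with n % p in eq
  ... | zero  = m%n≡0⇒n∣m n p eq
  ... | r@(suc _) = ⊥-elim (bezout (coprime-Bézout (prime⇒coprime p-prime r<p)))
    where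
    r<p : r < p
    r<p = ≡.subst (_< p) eq (m%n<n n p)
    r·1≈0 : r · 1# ≈ 0#
    r·1≈0 = begin
      r · 1#                                 ≈⟨ +-identityʳ _ ⟨
      r · 1# + 0#                            ≈⟨ +-congˡ (p∣⇒·≈0 (n∣m*n (n / p)) 1#) ⟨
      r · 1# + (n / p ℕ.* p) · 1#            ≈⟨ ×-homo-+ 1# r (n / p ℕ.* p) ⟨
      (r ℕ.+ n / p ℕ.* p) · 1#               ≈⟨ ×-congˡ (≡.cong (ℕ._+ n / p ℕ.* p) eq) ⟨
      (n % p ℕ.+ n / p ℕ.* p) · 1#           ≈⟨ ×-congˡ (m≡m%n+[m/n]*n n p) ⟨
      n · 1#                                 ≈⟨ n·1≈0 ⟩
      0#                                     ∎
    1≈0 : ∀ x y {m n} → m · 1# ≈ 0# → n · 1# ≈ 0# → 1 ℕ.+ y ℕ.* n ≡ x ℕ.* m → 1# ≈ 0#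
    1≈0 x y {m} {n} m·1≈0 n·1≈0 eq = begin
      1#                       ≈⟨ 1+m*n·1≈1 y n n·1≈0 ⟨
      (1 ℕ.+ y ℕ.* n) · 1#     ≈⟨ ×-congˡ eq ⟩
      (x ℕ.* m) · 1#           ≈⟨ ×1-homo-* x m ⟩
      (x · 1#) * (m · 1#)      ≈⟨ *-congˡ m·1≈0 ⟩
      (x · 1#) * 0#            ≈⟨ zeroʳ _ ⟩
      0#                       ∎
    bezout : Bézout.Identity 1 p r → ⊥
    bezout (Bézout.+- x y eq) = #⇒≉ 1#0 (1≈0 x y p·1≈0 r·1≈0 eq)
    bezout (Bézout.-+ x y eq) = #⇒≉ 1#0 (1≈0 y x r·1≈0 p·1≈0 eq)

  ·1≈⇒p∣∸ : ∀ {m n} → m ≤ n → m · 1# ≈ n · 1# → p ∣ n ∸ m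
  ·1≈⇒p∣∸ {m} {n} m≤n eq = ·1≈0⇒p∣ (+-cancelˡ (m · 1#) _ _ (begin
    m · 1# + (n ∸ m) · 1#  ≈⟨ ×-homo-+ 1# m (n ∸ m) ⟨
    (m ℕ.+ (n ∸ m)) · 1#   ≈⟨ ×-congˡ (ℕ.m+[n∸m]≡n m≤n) ⟩
    n · 1#                 ≈⟨ eq ⟨
    m · 1#                 ≈⟨ +-identityʳ _ ⟨
    m · 1# + 0#            ∎))

  ·1-injective-≤ : ∀ {m n} → m ≤ n → n < p → m · 1# ≈ n · 1# → m ≡ n
  ·1-injective-≤ {m} {n} m≤n n<p eq with n ∸ m in n∸m≡ | ·1≈⇒p∣∸ m≤n eq
  ... | zero  | _     = ℕ.≤-antisym m≤n (ℕ.m∸n≡0⇒m≤n n∸m≡)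
  ... | suc k | p∣1+k = ⊥-elim (ℕ.<⇒≱ (ℕ.≤-<-trans (ℕ.m∸n≤m n m) n<p)
                          (≡.subst (p ≤_) (≡.sym n∸m≡) (∣⇒≤ p∣1+k)))

  ·1-injective : ∀ {m n} → m < p → n < p → m · 1# ≈ n · 1# → m ≡ n
  ·1-injective {m} {n} m<p n<p eq with ℕ.≤-total m n
  ... | inj₁ m≤n = ·1-injective-≤ m≤n n<p eq
  ... | inj₂ n≤m = ≡.sym (·1-injective-≤ n≤m m<p (sym eq))

  -- All binomial coefficients except the two outer ones are divisible by p.
  frobenius : ∀ x y → (x + y) ^ p ≈ x ^ p + y ^ p
  frobenius x y = helper p ≡.refl
    where
    term : ∀ n → Fin (suc n) → Carrier
    term = Bin.binomialTerm x y
    -- A variable exponent can be matched as a successor, which exposes the first and the last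
    -- binomial term.
    helper : ∀ n → n ≡ p → (x + y) ^ n ≈ x ^ n + y ^ n
    helper zero eq = ⊥-elim (ℕ.≢-nonZero⁻¹ p (≡.sym eq))
    helper n@(suc n-1) ≡.refl = begin
      (x + y) ^ n                                               ≈⟨ Bin.theorem n x y ⟩
      term n Fin.zero + sum (term n ∘ Fin.suc)                  ≈⟨ +-congˡ (Sum.sum-init-last (term n ∘ Fin.suc)) ⟩
      term n Fin.zero + (sum middle + term n (Fin.suc (Fin.fromℕ n-1)))
        ≈⟨ +-cong first (+-cong middle≈0 last) ⟩
      y ^ n + (0# + x ^ n)                                      ≈⟨ +-congˡ (+-identityˡ _) ⟩
      y ^ n + x ^ n                                             ≈⟨ +-comm _ _ ⟩
      x ^ n + y ^ n                                             ∎
      where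
      middle : Fin n-1 → Carrier
      middle i = term n (Fin.suc (Fin.inject₁ i))
      first : term n Fin.zero ≈ y ^ n
      first = trans (×-homo-1 _) (*-identityˡ _)
      last : term n (Fin.suc (Fin.fromℕ n-1)) ≈ x ^ n
      last = begin
        (n C suc (toℕ (Fin.fromℕ n-1))) · (x ^ suc (toℕ (Fin.fromℕ n-1)) * y ^ (n ∸ suc (toℕ (Fin.fromℕ n-1))))
          ≈⟨ ×-cong (≡.trans (≡.cong (λ k → n C suc k) (Fin.toℕ-fromℕ n-1)) (nCn≡1 n))
                    (*-cong (^-congʳ x (≡.cong suc (Fin.toℕ-fromℕ n-1)))
                            (^-congʳ y (≡.trans (≡.cong (n-1 ∸_) (Fin.toℕ-fromℕ n-1)) (ℕ.n∸n≡0 n-1)))) ⟩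
        1 · (x ^ n * 1#)  ≈⟨ ×-homo-1 _ ⟩
        x ^ n * 1#        ≈⟨ *-identityʳ _ ⟩
        x ^ n             ∎
      middle≈0 : sum middle ≈ 0#
      middle≈0 = trans
        (Sum.sum-cong-≋ λ i → p∣⇒·≈0 (prime∣C p-prime (suc (toℕ (Fin.inject₁ i))) (s≤s z≤n)
            (s≤s (≡.subst (_< n-1) (≡.sym (Fin.toℕ-inject₁ i)) (Fin.toℕ<n i)))) _)
        (Sum.sum-replicate-zero n-1)

  ^p^-+ : ∀ j x y → (x + y) ^ (p ℕ.^ j) ≈ x ^ (p ℕ.^ j) + y ^ (p ℕ.^ j)
  ^p^-+ zero    x y = trans (*-identityʳ _) (sym (+-cong (*-identityʳ x) (*-identityʳ y)))
  ^p^-+ (suc j) x y = begin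
    (x + y) ^ (p ℕ.* p ℕ.^ j)                           ≈⟨ ^-assocʳ (x + y) p (p ℕ.^ j) ⟨
    ((x + y) ^ p) ^ (p ℕ.^ j)                           ≈⟨ ^-congˡ (p ℕ.^ j) (frobenius x y) ⟩
    (x ^ p + y ^ p) ^ (p ℕ.^ j)                         ≈⟨ ^p^-+ j (x ^ p) (y ^ p) ⟩
    (x ^ p) ^ (p ℕ.^ j) + (y ^ p) ^ (p ℕ.^ j)           ≈⟨ +-cong (^-assocʳ x p _) (^-assocʳ y p _) ⟩
    x ^ (p ℕ.* p ℕ.^ j) + y ^ (p ℕ.* p ℕ.^ j)           ∎

  -- Agrees definitionally with `Cyclotomy.Tr`, so that the results below apply to the residue in
  -- the exponent of ψ.
  trace : Carrier → Carrier
  trace x = sum {f} (λ j → x ^ (p ℕ.^ toℕ j))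

  trace-cong : ∀ {x y} → x ≈ y → trace x ≈ trace y
  trace-cong x≈y = Sum.sum-cong-≋ {f} λ j → ^-congˡ (p ℕ.^ toℕ j) x≈y

  trace-+ : ∀ x y → trace (x + y) ≈ trace x + trace y
  trace-+ x y = trans (Sum.sum-cong-≋ {f} λ j → ^p^-+ (toℕ j) x y) (Sum.∑-distrib-+ {f} _ _)

  0^p≈0 : 0# ^ p ≈ 0#
  0^p≈0 = helper (ℕ.>-nonZero⁻¹ p)
    where
    helper : ∀ {n} → 0 < n → 0# ^ n ≈ 0#
    helper {suc n} _ = zeroˡ _

  sum-frobenius : ∀ {n} (t : Fin n → Carrier) → sum t ^ p ≈ sum (λ i → t i ^ p)
  sum-frobenius {zero}  t = 0^p≈0
  sum-frobenius {suc n} t = trans (frobenius _ _) (+-congˡ (sum-frobenius (t ∘ Fin.suc)))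

  -- The Frobenius map shifts the summands cyclically, because x^(p^f) = x^q = x.
  trace^p≈trace : ∀ x → trace x ^ p ≈ trace x
  trace^p≈trace x = begin
    trace x ^ p                                     ≈⟨ sum-frobenius {f} _ ⟩
    sum {f} (λ j → (x ^ (p ℕ.^ toℕ j)) ^ p)         ≈⟨ Sum.sum-cong-≋ {f} (λ j → trans (^-assocʳ x (p ℕ.^ toℕ j) p) (^-congʳ x (ℕ.*-comm (p ℕ.^ toℕ j) p))) ⟩
    sum {f} (λ j → power (suc (toℕ j)))             ≈⟨ telescope f power periodic ⟩
    sum {f} (λ j → power (toℕ j))                   ∎
    where
    power : ℕ → Carrier
    power j = x ^ (p ℕ.^ j)
    periodic : power f ≈ power 0
    periodic = trans (^-congʳ x (≡.sym q≡p^f)) (trans (x^q≈x x) (sym (*-identityʳ x)))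
    telescope : ∀ f (g : ℕ → Carrier) → g f ≈ g 0 →
                sum {f} (λ j → g (suc (toℕ j))) ≈ sum {f} (λ j → g (toℕ j))
    telescope zero    g _  = refl
    telescope (suc n) g gf≈g0 = begin
      sum {suc n} (λ j → g (suc (toℕ j)))
        ≈⟨ Sum.sum-init-last {n} (λ j → g (suc (toℕ j))) ⟩
      sum {n} (λ j → g (suc (toℕ (Fin.inject₁ j)))) + g (suc (toℕ (Fin.fromℕ n)))
        ≈⟨ +-cong (reflexive (Sum.sum-cong-≗ {n} λ j → ≡.cong (g ∘ suc) (Fin.toℕ-inject₁ j)))
                  (trans (reflexive (≡.cong (g ∘ suc) (Fin.toℕ-fromℕ n))) gf≈g0) ⟩
      sum {n} (λ j → g (suc (toℕ j))) + g 0                 ≈⟨ +-comm _ _ ⟩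
      g 0 + sum {n} (λ j → g (suc (toℕ j)))                 ∎

  [n·1]^p≈n·1 : ∀ n → (n · 1#) ^ p ≈ n · 1#
  [n·1]^p≈n·1 zero    = 0^p≈0
  [n·1]^p≈n·1 (suc n) = trans (frobenius _ _) (+-cong (1^ p) ([n·1]^p≈n·1 n))

  Monic-x^p-x : Monic p (λ x → x ^ p - x)
  Monic-x^p-x = helper p (ℕ.nonTrivial⇒n>1 p {{prime⇒nonTrivial p-prime}})
    where
    -- With an exponent of at least 2, the term -x stays below the leading term.
    helper : ∀ n → 1 < n → Monic n (λ x → x ^ n - x)
    helper (suc zero)    (s≤s ())
    helper (suc (suc k)) _ = 0# , _ , (- 1# , _ , Monic-^ k , λ _ → refl) , λ x → begin
      x * (x * x ^ k) - x             ≈⟨ +-congˡ (trans (-‿cong (sym (*-identityʳ x))) (-‿distribʳ-* x 1#)) ⟩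
      x * (x * x ^ k) + x * - 1#      ≈⟨ distribˡ x _ _ ⟨
      x * (x * x ^ k + - 1#)          ≈⟨ *-congˡ (+-comm _ _) ⟩
      x * (- 1# + x * x ^ k)          ≈⟨ +-identityˡ _ ⟨
      0# + x * (- 1# + x * x ^ k)     ∎

  -- The p multiples of 1 are already roots of x^p - x, so a further root would exceed its degree.
  x^p≈x⇒prime-field : ∀ {x} → x ^ p ≈ x → ∃ λ (n : Fin p) → toℕ n · 1# ≈ x
  x^p≈x⇒prime-field {x} x^p≈x with Fin.any? (λ (n : Fin p) → toℕ n · 1# ≟ x)
  ... | yes found  = found
  ... | no missing = ⊥-elim (Monic-roots p Monic-x^p-x root root-injective (λ i → x≈y⇒x∙y⁻¹≈ε (root^p i)))
    where
    root : Fin (suc p) → Carrier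
    root Fin.zero    = x
    root (Fin.suc i) = toℕ i · 1#
    root^p : ∀ i → root i ^ p ≈ root i
    root^p Fin.zero    = x^p≈x
    root^p (Fin.suc i) = [n·1]^p≈n·1 (toℕ i)
    root-injective : ∀ {i j} → root i ≈ root j → i ≡ j
    root-injective {Fin.zero}  {Fin.zero}  _  = ≡.refl
    root-injective {Fin.zero}  {Fin.suc j} eq = ⊥-elim (missing (j , sym eq))
    root-injective {Fin.suc i} {Fin.zero}  eq = ⊥-elim (missing (i , eq))
    root-injective {Fin.suc i} {Fin.suc j} eq =
      ≡.cong Fin.suc (Fin.toℕ-injective (·1-injective (Fin.toℕ<n i) (Fin.toℕ<n j) eq))

-- The rationals inside a field of characteristic zero

module RationalEmbedding (K : HeytingField a ℓ₁ ℓ₂) (char0 : CharacteristicZero K) where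
  open FieldOps K hiding (zero)
  open HeytingFieldProperties K
  open SetoidReasoning setoid

  n·1≈0⇒n≡0 : ∀ {n} → n · 1# ≈ 0# → n ≡ 0
  n·1≈0⇒n≡0 {zero}  _  = ≡.refl
  n·1≈0⇒n≡0 {suc n} eq = ⊥-elim (#⇒≉ (char0 n) eq)

  ·1-injective : ∀ m n → m · 1# ≈ n · 1# → m ≡ n
  ·1-injective zero    n       eq = ≡.sym (n·1≈0⇒n≡0 (sym eq))
  ·1-injective (suc m) zero    eq = n·1≈0⇒n≡0 eq
  ·1-injective (suc m) (suc n) eq = ≡.cong suc (·1-injective m n (+-cancelˡ 1# _ _ eq))

  fromℤ-injective : ∀ i j → fromℤ i ≈ fromℤ j → i ≡ j
  fromℤ-injective (+ m)    (+ n)    eq = ≡.cong +_ (·1-injective m n eq)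
  fromℤ-injective -[1+ m ] -[1+ n ] eq = ≡.cong -[1+_] (ℕ.suc-injective (·1-injective (suc m) (suc n) (begin
    suc m · 1#        ≈⟨ -‿involutive _ ⟨
    - - (suc m · 1#)  ≈⟨ -‿cong eq ⟩
    - - (suc n · 1#)  ≈⟨ -‿involutive _ ⟩
    suc n · 1#        ∎)))
  -- Opposite signs would make (n + 1 + m) · 1 vanish.
  fromℤ-injective (+ m)    -[1+ n ] eq = ⊥-elim (#⇒≉ (char0 (n ℕ.+ m)) (begin
    suc (n ℕ.+ m) · 1#        ≈⟨ ×-homo-+ 1# (suc n) m ⟩
    suc n · 1# + m · 1#       ≈⟨ +-congˡ eq ⟩
    suc n · 1# - suc n · 1#   ≈⟨ -‿inverseʳ _ ⟩
    0#                        ∎))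
  fromℤ-injective -[1+ m ] (+ n) eq = ≡.sym (fromℤ-injective (+ n) -[1+ m ] (sym eq))

  fromℤ-*-+ : ∀ i d → fromℤ (i ℤ.* + suc d) ≈ fromℤ i * (suc d · 1#)
  fromℤ-*-+ (+ m)    d = trans (reflexive (≡.cong fromℤ (≡.sym (ℤ.pos-* m (suc d))))) (×1-homo-* m (suc d))
  fromℤ-*-+ -[1+ m ] d = trans (-‿cong (×1-homo-* (suc m) (suc d))) (-‿distribˡ-* _ _)

  fromℚ-* : ∀ x → fromℚ K char0 x * (suc (ℚ.denominator-1 x) · 1#) ≈ fromℤ (ℚ.↥ x)
  fromℚ-* x = trans (*-assoc _ _ _) (trans (*-congˡ unit) (*-identityʳ _))
    where
    unit : proj₁ (#⇒invertible (char0 (ℚ.denominator-1 x))) * (suc (ℚ.denominator-1 x) · 1#) ≈ 1#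
    unit = proj₂ (inverse (char0 (ℚ.denominator-1 x)))

  -- Clearing both denominators leaves an equation between integers. It keeps α₁, α₂, α₃ distinct as
  -- elements of K.
  fromℚ-injective : ∀ {x y} → fromℚ K char0 x ≈ fromℚ K char0 y → x ≡ y
  fromℚ-injective {x} {y} eq = ℚ.≃⇒≡ (ℚ.*≡* (fromℤ-injective _ _ (begin
    fromℤ (ℚ.↥ x ℤ.* + suc dʸ)                         ≈⟨ fromℤ-*-+ (ℚ.↥ x) dʸ ⟩
    fromℤ (ℚ.↥ x) * (suc dʸ · 1#)                      ≈⟨ *-congʳ (fromℚ-* x) ⟨
    fromℚ K char0 x * (suc dˣ · 1#) * (suc dʸ · 1#)    ≈⟨ *-assoc _ _ _ ⟩
    fromℚ K char0 x * ((suc dˣ · 1#) * (suc dʸ · 1#))  ≈⟨ *-cong eq (*-comm _ _) ⟩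
    fromℚ K char0 y * ((suc dʸ · 1#) * (suc dˣ · 1#))  ≈⟨ *-assoc _ _ _ ⟨
    fromℚ K char0 y * (suc dʸ · 1#) * (suc dˣ · 1#)    ≈⟨ *-congʳ (fromℚ-* y) ⟩
    fromℤ (ℚ.↥ y) * (suc dˣ · 1#)                      ≈⟨ fromℤ-*-+ (ℚ.↥ y) dˣ ⟨
    fromℤ (ℚ.↥ y ℤ.* + suc dˣ)                         ∎)))
    where
    dˣ dʸ : ℕ
    dˣ = ℚ.denominator-1 x
    dʸ = ℚ.denominator-1 y

-- Transport of schemes along isomorphisms

module _ {X : Setoid a ℓ₁} {Y : Setoid b ℓ₂} (φ : Inverse X Y) where
  private
    module X = Setoid X
    module Y = Setoid Y
    module φ = Inverse φ

  finite-transport : Finite X → Finite Y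
  finite-transport (n , e) = n , Composition.inverse e φ

  count-transport : ∀ (finite : Finite X) {P : Pred X.Carrier r} {Q : Pred Y.Carrier s}
                    (P? : Decidable P) (Q? : Decidable Q) →
                    (∀ x → P x ⇔ Q (φ.to x)) →
                    count (finite-transport finite) Q? ≡ count finite P?
  count-transport (n , e) {P} {Q} P? Q? P⇔Q = helper (List.allFin n)
    where
    helper : ∀ is → List.length (List.filter Q? (List.map (φ.to ∘ Inverse.to e) is)) ≡
                    List.length (List.filter P? (List.map (Inverse.to e) is))
    helper []       = ≡.refl
    helper (i ∷ is) with P? (Inverse.to e i) | Q? (φ.to (Inverse.to e i))
    ... | yes p | yes q = ≡.cong suc (helper is)
    ... | no ¬p | no ¬q = helper is
    ... | yes p | no ¬q = ⊥-elim (¬q (Equivalence.to (P⇔Q _) p))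
    ... | no ¬p | yes q = ⊥-elim (¬p (Equivalence.from (P⇔Q _) q))

  module _ {R : Fin (suc d) → Rel X.Carrier r} {S : Fin (suc d) → Rel Y.Carrier s}
           (S-resp : ∀ i {y y′ z z′} → y Y.≈ y′ → z Y.≈ z′ → S i y z → S i y′ z′)
           (R⇔S : ∀ i x y → R i x y ⇔ S i (φ.to x) (φ.to y)) where

    associationScheme-transport : IsAssociationScheme X R → IsAssociationScheme Y S
    associationScheme-transport scheme = record
      { finite             = finite-transport S.finite
      ; isPartition        = isPartition
      ; diagonal           = λ y z → mk⇔
          (λ S₀ → from-injective (Equivalence.to (S.diagonal _ _) (S⇒R S₀)))
          (λ y≈z → R⇒S (Equivalence.from (S.diagonal _ _) (φ.from-cong y≈z)))
      ; symmetric          = λ i Syz → R⇒S (S.symmetric i (S⇒R Syz))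
      ; intersectionNumber = S.intersectionNumber
      ; regular            = λ i j k {y} {z} Syz → ≡.trans
          (count-transport S.finite
            (λ x → S.R? i (φ.from y) x ×-dec S.R? j x (φ.from z))
            (λ w → S? i y w ×-dec S? j w z)
            (λ x → mk⇔
              (λ (Ri , Rj) → S-resp i (φ.strictlyInverseˡ y) Y.refl (Equivalence.to (R⇔S i _ _) Ri)
                           , S-resp j Y.refl (φ.strictlyInverseˡ z) (Equivalence.to (R⇔S j _ _) Rj))
              (λ (Si , Sj) → Equivalence.from (R⇔S i _ _) (S-resp i (Y.sym (φ.strictlyInverseˡ y)) Y.refl Si)
                           , Equivalence.from (R⇔S j _ _) (S-resp j Y.refl (Y.sym (φ.strictlyInverseˡ z)) Sj))))
          (S.regular i j k (S⇒R Syz))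
      }
      where
      module S = IsAssociationScheme scheme
      module P = IsPartition S.isPartition

      S⇒R : ∀ {i y z} → S i y z → R i (φ.from y) (φ.from z)
      S⇒R {i} Syz = Equivalence.from (R⇔S i _ _)
        (S-resp i (Y.sym (φ.strictlyInverseˡ _)) (Y.sym (φ.strictlyInverseˡ _)) Syz)

      R⇒S : ∀ {i y z} → R i (φ.from y) (φ.from z) → S i y z
      R⇒S {i} Rxy = S-resp i (φ.strictlyInverseˡ _) (φ.strictlyInverseˡ _) (Equivalence.to (R⇔S i _ _) Rxy)

      from-injective : ∀ {y z} → φ.from y X.≈ φ.from z → y Y.≈ z
      from-injective eq = Y.trans (Y.sym (φ.strictlyInverseˡ _)) (Y.trans (φ.to-cong eq) (φ.strictlyInverseˡ _))

      isPartition : IsPartition (Y ×ₛ Y) (λ i → uncurry (S i))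
      isPartition = record
        { respects  = λ i (y≈y′ , z≈z′) → S-resp i y≈y′ z≈z′
        ; inhabited = λ i → let (x , y) , Rxy = P.inhabited i in
                            (φ.to x , φ.to y) , Equivalence.to (R⇔S i x y) Rxy
        ; classify  = λ (y , z) → let i , Ri , unique = P.classify (φ.from y , φ.from z) in
                                  i , R⇒S Ri , λ Sj → unique (S⇒R Sj)
        }

      -- The counts in `regular` are taken with the decision procedure read off the partition, so
      -- the transported count has to use that very one.
      S? : ∀ i y z → Dec (S i y z)
      S? i y z = IsPartition.class? isPartition i (y , z)

module _ (X : AbelianGroup a ℓ₁) (Y : AbelianGroup b ℓ₂) where
  private
    module X = AbelianGroup X
    module Y = AbelianGroup Y

  module _ (φ : Inverse X.setoid Y.setoid)
           (φ-homo : ∀ x y → Inverse.to φ (x X.∙ y) Y.≈ Inverse.to φ x Y.∙ Inverse.to φ y)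
           {D : Fin (suc d) → Pred X.Carrier r} {E : Fin (suc d) → Pred Y.Carrier s}
           {R : Fin (suc d) → Rel X.Carrier ℓ}
           (E-isPartition : IsPartition Y.setoid E)
           (D⇔E : ∀ i x → D i x ⇔ E i (Inverse.to φ x))
           (scheme : IsTranslationScheme X D R) where
    private
      module φ = Inverse φ
      module S = IsTranslationScheme scheme
      module E = IsPartition E-isPartition

      to-injective : ∀ {x y} → φ.to x Y.≈ φ.to y → x X.≈ y
      to-injective eq = X.trans (X.sym (φ.strictlyInverseʳ _)) (X.trans (φ.from-cong eq) (φ.strictlyInverseʳ _))

      φ-ε : φ.to X.ε Y.≈ Y.ε
      φ-ε = identityʳ-unique _ _ (Y.trans (Y.sym (φ-homo X.ε X.ε)) (φ.to-cong (X.identityˡ X.ε)))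
        where open AbelianGroupProperties Y using (identityʳ-unique)

      E⇒D : ∀ i {y} → E i y → D i (φ.from y)
      E⇒D i Ey = Equivalence.from (D⇔E i _) (E.respects i (Y.sym (φ.strictlyInverseˡ _)) Ey)

    translate-transport : ∀ i x y → R i x y ⇔ Translate Y E i (φ.to x) (φ.to y)
    translate-transport i x y = mk⇔
      (λ Rxy → let w , Dw , y≈xw = Equivalence.to (S.translation i x y) Rxy in
        φ.to w , Equivalence.to (D⇔E i w) Dw , Y.trans (φ.to-cong y≈xw) (φ-homo x w))
      (λ (w , Ew , eq) → Equivalence.from (S.translation i x y)
        (φ.from w , E⇒D i Ew , to-injective (Y.trans eq (Y.trans
          (Y.∙-congˡ (Y.sym (φ.strictlyInverseˡ w))) (Y.sym (φ-homo x (φ.from w)))))))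

    translationScheme-transport : IsTranslationScheme Y E (Translate Y E)
    translationScheme-transport = record
      { isPartition         = E-isPartition
      ; identity            = λ y → mk⇔
          (λ Ey → Y.trans (Y.sym (φ.strictlyInverseˡ y))
                    (Y.trans (φ.to-cong (Equivalence.to (S.identity _) (E⇒D _ Ey))) φ-ε))
          (λ y≈ε → E.respects _ (Y.trans φ-ε (Y.sym y≈ε))
                     (Equivalence.to (D⇔E _ _) (Equivalence.from (S.identity X.ε) X.refl)))
      ; translation         = λ i x y → mk⇔ id id
      ; isAssociationScheme = associationScheme-transport φ
          (λ i y≈y′ z≈z′ (w , Ew , eq) → w , Ew ,
            Y.trans (Y.sym z≈z′) (Y.trans eq (Y.∙-congʳ y≈y′)))
          translate-transport S.isAssociationScheme
      }

-- Fourier analysis on a finite field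

module AdditiveCharacters
  (F : HeytingField a ℓ₁ ℓ₂) {q : ℕ} (enum : Enumeration q (FieldOps.setoid F))
  (K : HeytingField b ℓ₃ ℓ₄) (char0 : CharacteristicZero K)
  where
  private
    module F where
      open FieldOps F public
      open HeytingFieldProperties F public
    Ĝ = characterGroup F.+-abelianGroup K
  open FieldOps K hiding (zero)
  open HeytingFieldProperties K
  open FiniteField F enum public
  open FiniteSums K enum public
  open SetoidReasoning setoid
  private
    open module Char (χ : Character F.+-abelianGroup K) = Character χ using (⟦_⟧; ⟦⟧-cong; homo; ε-homo)

  private
    module Ĝ = AbelianGroup Ĝ

  δ : F.Carrier → Carrier
  δ x = indicator (x ≟ F.0#)

  δ-no : ∀ {x} → ¬ x F.≈ F.0# → δ x ≈ 0#
  δ-no = indicator-no (_ ≟ F.0#)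

  δ-yes : ∀ {x} → x F.≈ F.0# → δ x ≈ 1#
  δ-yes = indicator-yes (_ ≟ F.0#)

  δ-cong : ∀ {x y} → x F.≈ y → δ x ≈ δ y
  δ-cong x≈y = indicator-⇔ (_ ≟ F.0#) (_ ≟ F.0#) (F.trans (F.sym x≈y)) (F.trans x≈y)

  q#0 : (q · 1#) # 0#
  q#0 = helper 0<q
    where
    helper : ∀ {n} → 0 < n → (n · 1#) # 0#
    helper {suc n} _ = char0 n

  -- Translating the summation variable by y multiplies the sum by χ(y). A nonzero sum therefore
  -- forces χ to be trivial.
  character-∑ : ∀ χ y → ⟦ χ ⟧ y * ∑ ⟦ χ ⟧ ≈ ∑ ⟦ χ ⟧
  character-∑ χ y = begin
    ⟦ χ ⟧ y * ∑ ⟦ χ ⟧               ≈⟨ *-distribˡ-∑ _ _ ⟩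
    ∑ (λ x → ⟦ χ ⟧ y * ⟦ χ ⟧ x)     ≈⟨ ∑-cong (λ x → *-comm _ _) ⟩
    ∑ (λ x → ⟦ χ ⟧ x * ⟦ χ ⟧ y)     ≈⟨ ∑-cong (λ x → homo χ x y) ⟨
    ∑ (λ x → ⟦ χ ⟧ (x F.+ y))       ≈⟨ ∑-permute (translation y) ⟦ χ ⟧ (⟦⟧-cong χ) ⟩
    ∑ ⟦ χ ⟧                         ∎

  ∑≉0⇒trivial : ∀ χ → ¬ ∑ ⟦ χ ⟧ ≈ 0# → ∀ y → ⟦ χ ⟧ y ≈ 1#
  ∑≉0⇒trivial χ ∑≉0 y = *-cancelˡ ∑≉0 (begin
    ∑ ⟦ χ ⟧ * ⟦ χ ⟧ y  ≈⟨ *-comm _ _ ⟩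
    ⟦ χ ⟧ y * ∑ ⟦ χ ⟧  ≈⟨ character-∑ χ y ⟩
    ∑ ⟦ χ ⟧            ≈⟨ *-identityʳ _ ⟨
    ∑ ⟦ χ ⟧ * 1#       ∎)

  nontrivial⇒∑≈0 : ∀ χ {y} → ¬ ⟦ χ ⟧ y ≈ 1# → ∑ ⟦ χ ⟧ ≈ 0#
  nontrivial⇒∑≈0 χ χy≉1 = ≈-stable λ ∑≉0 → χy≉1 (∑≉0⇒trivial χ ∑≉0 _)

  module Fourier (ψ : Character F.+-abelianGroup K) (nontrivial : ∃ λ x → ¬ ⟦ ψ ⟧ x ≈ 1#) where

    -- The lemmas below make y ↦ `ψ[ y ]` an isomorphism from F onto its character group.
    ψ[_] : F.Carrier → Character F.+-abelianGroup K
    ψ[ y ] = record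
      { ⟦_⟧ = λ x → ⟦ ψ ⟧ (y F.* x)
      ; isMonoidHomomorphism = record
        { isMagmaHomomorphism = record
          { isRelHomomorphism = record { cong = ⟦⟧-cong ψ ∘ F.*-congˡ }
          ; homo = λ x x′ → trans (⟦⟧-cong ψ (F.distribˡ y x x′)) (homo ψ _ _)
          }
        ; ε-homo = trans (⟦⟧-cong ψ (F.zeroʳ y)) (ε-homo ψ)
        }
      }

    ψ[]-cong : ∀ {y y′} → y F.≈ y′ → ψ[ y ] Ĝ.≈ ψ[ y′ ]
    ψ[]-cong y≈y′ x = ⟦⟧-cong ψ (F.*-congʳ y≈y′)

    ψ[]-homo : ∀ y y′ → ψ[ y F.+ y′ ] Ĝ.≈ (ψ[ y ] Ĝ.∙ ψ[ y′ ])
    ψ[]-homo y y′ x = trans (⟦⟧-cong ψ (F.distribʳ x y y′)) (homo ψ _ _)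

    ψ[]-sym : ∀ x y → ⟦ ψ[ x ] ⟧ y ≈ ⟦ ψ[ y ] ⟧ x
    ψ[]-sym x y = ⟦⟧-cong ψ (F.*-comm x y)

    -- For y ≠ 0 the character `ψ[ y ]` is nontrivial: it takes at x / y the value that ψ takes at
    -- x.
    orthogonality : ∀ y → ∑ ⟦ ψ[ y ] ⟧ ≈ (q · 1#) * δ y
    orthogonality y = case y ≟ F.0# of λ where
      (yes y≈0) → begin
        ∑ ⟦ ψ[ y ] ⟧     ≈⟨ ∑-cong (λ x → trans (⟦⟧-cong ψ (F.trans (F.*-congʳ y≈0) (F.zeroˡ x))) (ε-homo ψ)) ⟩
        ∑ (λ _ → 1#)     ≈⟨ ∑-const 1# ⟩
        q · 1#           ≈⟨ *-identityʳ _ ⟨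
        (q · 1#) * 1#    ≈⟨ *-congˡ (δ-yes y≈0) ⟨
        (q · 1#) * δ y   ∎
      (no y≉0) → let y⁻¹ , inv = F.inverse (≉0⇒#0 y≉0); x , ψx≉1 = nontrivial in begin
        ∑ ⟦ ψ[ y ] ⟧     ≈⟨ nontrivial⇒∑≈0 ψ[ y ] (λ eq → ψx≉1 (trans (⟦⟧-cong ψ (F.sym (F.*-cancel-inverse (F.trans (F.*-comm _ _) inv) x))) eq)) ⟩
        0#               ≈⟨ zeroʳ _ ⟨
        (q · 1#) * 0#    ≈⟨ *-congˡ (δ-no y≉0) ⟨
        (q · 1#) * δ y   ∎

    -- The character of x - y is trivial and sums to q, whereas orthogonality makes this sum 0
    -- unless x = y.
    ψ[]-injective : ∀ {x y} → ψ[ x ] Ĝ.≈ ψ[ y ] → x F.≈ y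
    ψ[]-injective {x} {y} eq = F.≈-stable λ x≉y → #⇒≉ q#0 (begin
      q · 1#                      ≈⟨ ∑-const 1# ⟨
      ∑ (λ _ → 1#)                ≈⟨ ∑-cong (λ z → trivial z) ⟨
      ∑ ⟦ ψ[ x F.- y ] ⟧          ≈⟨ orthogonality (x F.- y) ⟩
      (q · 1#) * δ (x F.- y)      ≈⟨ *-congˡ (δ-no (x≉y ∘ F.x∙y⁻¹≈ε⇒x≈y x y)) ⟩
      (q · 1#) * 0#               ≈⟨ zeroʳ _ ⟩
      0#                          ∎)
      where
      trivial : ∀ z → ⟦ ψ[ x F.- y ] ⟧ z ≈ 1#
      trivial z = begin
        ⟦ ψ[ x F.- y ] ⟧ z                ≈⟨ ψ[]-homo x (F.- y) z ⟩
        ⟦ ψ[ x ] ⟧ z * ⟦ ψ[ F.- y ] ⟧ z   ≈⟨ *-congʳ (eq z) ⟩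
        ⟦ ψ[ y ] ⟧ z * ⟦ ψ[ F.- y ] ⟧ z   ≈⟨ ψ[]-homo y (F.- y) z ⟨
        ⟦ ψ[ y F.- y ] ⟧ z                ≈⟨ ⟦⟧-cong ψ (F.trans (F.*-congʳ (F.-‿inverseʳ y)) (F.zeroˡ z)) ⟩
        ⟦ ψ ⟧ F.0#                        ≈⟨ ε-homo ψ ⟩
        1#                                ∎

    -- The Fourier coefficients of χ add up to q, so by cotransitivity one of them
    -- is apart from 0, and χ is then the corresponding character.
    ψ[]-surjective : ∀ χ → ∃ λ y → ψ[ y ] Ĝ.≈ χ
    ψ[]-surjective χ = y , λ x → begin
      ⟦ ψ[ y ] ⟧ x                                     ≈⟨ *-identityˡ _ ⟨
      1# * ⟦ ψ[ y ] ⟧ x                                ≈⟨ *-congʳ (∑≉0⇒trivial (twist y) (#⇒≉ (proj₂ found)) x) ⟨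
      (⟦ χ ⟧ x * ⟦ ψ[ F.- y ] ⟧ x) * ⟦ ψ[ y ] ⟧ x      ≈⟨ *-assoc _ _ _ ⟩
      ⟦ χ ⟧ x * (⟦ ψ[ F.- y ] ⟧ x * ⟦ ψ[ y ] ⟧ x)      ≈⟨ *-congˡ (ψ[]-homo (F.- y) y x) ⟨
      ⟦ χ ⟧ x * ⟦ ψ[ F.- y F.+ y ] ⟧ x                 ≈⟨ *-congˡ (trans (⟦⟧-cong ψ (F.trans (F.*-congʳ (F.-‿inverseˡ y)) (F.zeroˡ x))) (ε-homo ψ)) ⟩
      ⟦ χ ⟧ x * 1#                                     ≈⟨ *-identityʳ _ ⟩
      ⟦ χ ⟧ x                                          ∎
      where
      twist : F.Carrier → Character F.+-abelianGroup K
      twist y = χ Ĝ.∙ ψ[ F.- y ]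

      flip : ∀ y x → F.- y F.* x F.≈ F.- x F.* y
      flip y x = F.trans (F.sym (F.-‿distribˡ-* y x))
        (F.trans (F.-‿cong (F.*-comm y x)) (F.-‿distribˡ-* x y))

      -- `∑ ⟦ twist y ⟧` is the Fourier coefficient of χ at y. Summing over y first, orthogonality
      -- leaves only x = 0, where χ is 1.
      total : ∑ (λ y → ∑ ⟦ twist y ⟧) ≈ q · 1#
      total = begin
        ∑ (λ y → ∑ (λ x → ⟦ χ ⟧ x * ⟦ ψ[ F.- y ] ⟧ x))   ≈⟨ ∑-comm _ ⟩
        ∑ (λ x → ∑ (λ y → ⟦ χ ⟧ x * ⟦ ψ[ F.- y ] ⟧ x))   ≈⟨ ∑-cong (λ x → *-distribˡ-∑ _ _) ⟨
        ∑ (λ x → ⟦ χ ⟧ x * ∑ (λ y → ⟦ ψ[ F.- y ] ⟧ x))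
          ≈⟨ ∑-cong (λ x → *-congˡ (∑-cong (λ y → ⟦⟧-cong ψ (flip y x)))) ⟩
        ∑ (λ x → ⟦ χ ⟧ x * ∑ ⟦ ψ[ F.- x ] ⟧)             ≈⟨ ∑-cong (λ x → *-congˡ (orthogonality (F.- x))) ⟩
        ∑ (λ x → ⟦ χ ⟧ x * ((q · 1#) * δ (F.- x)))
          ≈⟨ ∑-single _ F.0#
               (λ x≈y → *-cong (⟦⟧-cong χ x≈y) (*-congˡ (δ-cong (F.-‿cong x≈y))))
               (λ x x≉0 → trans (*-congˡ (trans (*-congˡ (δ-no λ -x≈0 → x≉0
                 (F.trans (F.sym (F.-‿involutive x)) (F.trans (F.-‿cong -x≈0) F.-0#≈0#)))) (zeroʳ _))) (zeroʳ _)) ⟩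
        ⟦ χ ⟧ F.0# * ((q · 1#) * δ (F.- F.0#))           ≈⟨ *-cong (ε-homo χ) (*-congˡ (δ-yes F.-0#≈0#)) ⟩
        1# * ((q · 1#) * 1#)                             ≈⟨ trans (*-identityˡ _) (*-identityʳ _) ⟩
        q · 1#                                           ∎

      found : ∃ λ y → ∑ ⟦ twist y ⟧ # 0#
      found = ∑-#0 (#-congʳ (sym total) q#0)

      y : F.Carrier
      y = proj₁ found

-- Partitions of a finite field that are self-dual up to a dilation

module SelfDualPartition
  (F : HeytingField a ℓ₁ ℓ₂) {q : ℕ} (enum : Enumeration q (FieldOps.setoid F))
  (K : HeytingField b ℓ₃ ℓ₄) (char0 : CharacteristicZero K)
  (ψ : Character (FieldOps.+-abelianGroup F) K)
  (nontrivial : ∃ λ x → ¬ FieldOps._≈_ K (Character.⟦_⟧ ψ x) (FieldOps.1# K))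
  {d} {D : Fin (suc d) → Pred (FieldOps.Carrier F) r}
  (D-isPartition : IsPartition (FieldOps.setoid F) D)
  where
  private
    module F where
      open FieldOps F public
      open HeytingFieldProperties F public
    Ĝ = characterGroup F.+-abelianGroup K
    module Ĝ = AbelianGroup Ĝ
    module D = IsPartition D-isPartition
  open FieldOps K hiding (zero)
  open HeytingFieldProperties K
  open AdditiveCharacters F enum K char0
  open Fourier ψ nontrivial
  open SetoidReasoning setoid
  private
    open module Char (χ : Character F.+-abelianGroup K) = Character χ using (⟦_⟧; ⟦⟧-cong; homo; ε-homo)

  D? : ∀ i x → Dec (D i x)
  D? = D.class?

  representative : Fin (suc d) → F.Carrier
  representative i = proj₁ (D.inhabited i)

  representative∈ : ∀ i → D i (representative i)
  representative∈ i = proj₂ (D.inhabited i)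

  1[_] : Fin (suc d) → F.Carrier → Carrier
  1[ i ] x = indicator (D? i x)

  1[]-cong : ∀ i {x y} → x F.≈ y → 1[ i ] x ≈ 1[ i ] y
  1[]-cong i x≈y = indicator-⇔ (D? i _) (D? i _) (D.respects i x≈y) (D.respects i (F.sym x≈y))

  -- The character sum of a class at `ψ[ y ]`, which is the eigenvalue of the corresponding
  -- adjacency matrix at this character; as a function of y, the Fourier transform of the class.
  eigenvalue : Fin (suc d) → F.Carrier → Carrier
  eigenvalue i y = ∑ (λ x → 1[ i ] x * ⟦ ψ[ y ] ⟧ x)

  eigenvalue-cong : ∀ i {x y} → x F.≈ y → eigenvalue i x ≈ eigenvalue i y
  eigenvalue-cong i x≈y = ∑-cong λ z → *-congˡ (ψ[]-cong x≈y z)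

  IsClassFunction : (F.Carrier → Carrier) → Set _
  IsClassFunction g = ∀ k {x y} → D k x → D k y → g x ≈ g y

  1[]-class : ∀ i → IsClassFunction 1[ i ]
  1[]-class i k {x} {y} Dx Dy = indicator-⇔ (D? i x) (D? i y) (move Dx Dy) (move Dy Dx)
    where
    move : ∀ {x y} → D k x → D k y → D i x → D i y
    move {x} {y} Dkx Dky Dix with j , _ , unique ← D.classify x =
      ≡.subst (λ l → D l y) (≡.trans (≡.sym (unique Dkx)) (unique Dix)) Dky

  class-function-expansion : ∀ g → IsClassFunction g →
                             ∀ x → g x ≈ sum (λ l → g (representative l) * 1[ l ] x)
  class-function-expansion g g-class x = sym (begin
    sum (λ l → g (representative l) * 1[ l ] x)
      ≈⟨ sum-single (CommutativeRing.+-commutativeMonoid commutativeRing) _ i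
           (λ l l≢i → trans (*-congˡ {g (representative l)} (indicator-no (D? l x) (l≢i ∘ ≡.sym ∘ unique))) (zeroʳ _)) ⟩
    g (representative i) * 1[ i ] x    ≈⟨ *-cong (g-class i (representative∈ i) Dx) (indicator-yes (D? i x) Dx) ⟩
    g x * 1#                           ≈⟨ *-identityʳ _ ⟩
    g x                                ∎)
    where
    i = proj₁ (D.classify x)
    Dx = proj₁ (proj₂ (D.classify x))
    unique : ∀ {l} → D l x → i ≡ l
    unique = proj₂ (proj₂ (D.classify x))

  -- Source of every linear relation between the eigenvalues: `g` will be the constant 1, the Gauss
  -- period, and a product of two eigenvalues.
  transform-expansion : ∀ g → IsClassFunction g → ∀ y →
                        ∑ (λ z → g z * ⟦ ψ[ y ] ⟧ z) ≈ sum (λ l → g (representative l) * eigenvalue l y)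
  transform-expansion g g-class y = begin
    ∑ (λ z → g z * ⟦ ψ[ y ] ⟧ z)
      ≈⟨ ∑-cong (λ z → *-congʳ (class-function-expansion g g-class z)) ⟩
    ∑ (λ z → sum (λ l → g (representative l) * 1[ l ] z) * ⟦ ψ[ y ] ⟧ z)
      ≈⟨ ∑-cong (λ z → SemiringSum.*-distribʳ-sum semiring {suc d} _ (λ l → g (representative l) * 1[ l ] z)) ⟩
    ∑ (λ z → sum (λ l → (g (representative l) * 1[ l ] z) * ⟦ ψ[ y ] ⟧ z))
      ≈⟨ ∑-sum-comm {suc d} (λ z l → (g (representative l) * 1[ l ] z) * ⟦ ψ[ y ] ⟧ z) ⟩
    sum (λ l → ∑ (λ z → (g (representative l) * 1[ l ] z) * ⟦ ψ[ y ] ⟧ z))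
      ≈⟨ SemiringSum.sum-cong-≋ semiring {suc d}
           (λ l → trans (∑-cong (λ z → *-assoc (g (representative l)) (1[ l ] z) (⟦ ψ[ y ] ⟧ z)))
                        (sym (*-distribˡ-∑ (g (representative l)) _))) ⟩
    sum (λ l → g (representative l) * eigenvalue l y) ∎

  private
    v≈w-u⇒u+v-w≈0 : ∀ u v w → v F.≈ w F.- u → u F.+ v F.- w F.≈ F.0#
    v≈w-u⇒u+v-w≈0 u v w v≈w-u = F.x≈y⇒x∙y⁻¹≈ε (F.trans (F.+-congˡ v≈w-u) (F.trans (F.+-comm _ _)
      (F.trans (F.+-assoc _ _ _) (F.trans (F.+-congˡ (F.-‿inverseˡ u)) (F.+-identityʳ w)))))

    u+v-w≈0⇒v≈w-u : ∀ u v w → u F.+ v F.- w F.≈ F.0# → v F.≈ w F.- u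
    u+v-w≈0⇒v≈w-u u v w eq = F.sym (F.trans (F.+-congʳ (F.trans (F.sym (F.x∙y⁻¹≈ε⇒x≈y _ _ eq)) (F.+-comm u v)))
      (F.trans (F.+-assoc _ _ _) (F.trans (F.+-congˡ (F.-‿inverseʳ u)) (F.+-identityʳ v))))

  convolution : (i j : Fin (suc d)) → F.Carrier → Carrier
  convolution i j w = ∑ (λ u → 1[ i ] u * 1[ j ] (w F.- u))

  -- Fourier inversion, as the transform takes convolutions to products. After both eigenvalues are
  -- expanded, summation over x and orthogonality leave only the pairs with u + v = w.
  convolution-eigenvalue : ∀ i j w → (q · 1#) * convolution i j w ≈
                           ∑ (λ x → (eigenvalue i x * eigenvalue j x) * ⟦ ψ[ x ] ⟧ (F.- w))
  convolution-eigenvalue i j w = sym (begin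
    ∑ (λ x → (eigenvalue i x * eigenvalue j x) * ⟦ ψ[ x ] ⟧ (F.- w))
      ≈⟨ ∑-cong expand ⟩
    ∑ (λ x → ∑ (λ u → ∑ (λ v → k u v * ⟦ ψ[ x ] ⟧ (u F.+ v F.- w))))
      ≈⟨ ∑-comm _ ⟩
    ∑ (λ u → ∑ (λ x → ∑ (λ v → k u v * ⟦ ψ[ x ] ⟧ (u F.+ v F.- w))))
      ≈⟨ ∑-cong (λ u → ∑-comm _) ⟩
    ∑ (λ u → ∑ (λ v → ∑ (λ x → k u v * ⟦ ψ[ x ] ⟧ (u F.+ v F.- w))))
      ≈⟨ ∑-cong (λ u → ∑-cong (λ v → inner u v)) ⟩
    ∑ (λ u → ∑ (λ v → k u v * ((q · 1#) * δ (u F.+ v F.- w))))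
      ≈⟨ ∑-cong collapse ⟩
    ∑ (λ u → (q · 1#) * (1[ i ] u * 1[ j ] (w F.- u)))
      ≈⟨ *-distribˡ-∑ _ _ ⟨
    (q · 1#) * convolution i j w ∎)
    where
    k : F.Carrier → F.Carrier → Carrier
    k u v = 1[ i ] u * 1[ j ] v

    expand : ∀ x → (eigenvalue i x * eigenvalue j x) * ⟦ ψ[ x ] ⟧ (F.- w) ≈
             ∑ (λ u → ∑ (λ v → k u v * ⟦ ψ[ x ] ⟧ (u F.+ v F.- w)))
    expand x = begin
      (eigenvalue i x * eigenvalue j x) * ⟦ ψ[ x ] ⟧ (F.- w)    ≈⟨ *-assoc _ _ _ ⟩
      eigenvalue i x * (eigenvalue j x * ⟦ ψ[ x ] ⟧ (F.- w))    ≈⟨ *-distribʳ-∑ _ _ ⟩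
      ∑ (λ u → (1[ i ] u * ⟦ ψ[ x ] ⟧ u) * (eigenvalue j x * ⟦ ψ[ x ] ⟧ (F.- w)))
        ≈⟨ ∑-cong (λ u → trans (*-congˡ (*-distribʳ-∑ _ _)) (*-distribˡ-∑ _ _)) ⟩
      ∑ (λ u → ∑ (λ v → (1[ i ] u * ⟦ ψ[ x ] ⟧ u) * ((1[ j ] v * ⟦ ψ[ x ] ⟧ v) * ⟦ ψ[ x ] ⟧ (F.- w))))
        ≈⟨ ∑-cong (λ u → ∑-cong (λ v → regroup u v)) ⟩
      ∑ (λ u → ∑ (λ v → k u v * ⟦ ψ[ x ] ⟧ (u F.+ v F.- w))) ∎
      where
      regroup : ∀ u v → (1[ i ] u * ⟦ ψ[ x ] ⟧ u) * ((1[ j ] v * ⟦ ψ[ x ] ⟧ v) * ⟦ ψ[ x ] ⟧ (F.- w)) ≈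
                k u v * ⟦ ψ[ x ] ⟧ (u F.+ v F.- w)
      regroup u v = begin
        (1[ i ] u * ⟦ ψ[ x ] ⟧ u) * ((1[ j ] v * ⟦ ψ[ x ] ⟧ v) * ⟦ ψ[ x ] ⟧ (F.- w))
          ≈⟨ solve 5 (λ s u t v w → (s :* u) :* ((t :* v) :* w) := (s :* t) :* ((u :* v) :* w)) refl _ _ _ _ _ ⟩
        k u v * ((⟦ ψ[ x ] ⟧ u * ⟦ ψ[ x ] ⟧ v) * ⟦ ψ[ x ] ⟧ (F.- w))
          ≈⟨ *-congˡ (trans (homo ψ[ x ] (u F.+ v) (F.- w)) (*-congʳ (homo ψ[ x ] u v))) ⟨
        k u v * ⟦ ψ[ x ] ⟧ (u F.+ v F.- w) ∎
        where open Solver using (solve; _:*_; _:=_)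

    inner : ∀ u v → ∑ (λ x → k u v * ⟦ ψ[ x ] ⟧ (u F.+ v F.- w)) ≈
            k u v * ((q · 1#) * δ (u F.+ v F.- w))
    inner u v = begin
      ∑ (λ x → k u v * ⟦ ψ[ x ] ⟧ (u F.+ v F.- w))   ≈⟨ *-distribˡ-∑ _ _ ⟨
      k u v * ∑ (λ x → ⟦ ψ[ x ] ⟧ (u F.+ v F.- w))   ≈⟨ *-congˡ (∑-cong λ x → ψ[]-sym x _) ⟩
      k u v * ∑ ⟦ ψ[ u F.+ v F.- w ] ⟧               ≈⟨ *-congˡ (orthogonality _) ⟩
      k u v * ((q · 1#) * δ (u F.+ v F.- w))         ∎

    collapse : ∀ u → ∑ (λ v → k u v * ((q · 1#) * δ (u F.+ v F.- w))) ≈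
               (q · 1#) * (1[ i ] u * 1[ j ] (w F.- u))
    collapse u = begin
      ∑ (λ v → k u v * ((q · 1#) * δ (u F.+ v F.- w)))
        ≈⟨ ∑-single _ (w F.- u)
             (λ v≈v′ → *-cong (*-congˡ (1[]-cong j v≈v′)) (*-congˡ (δ-cong (F.+-congʳ (F.+-congˡ v≈v′)))))
             (λ v v≉ → trans (*-congˡ (trans (*-congˡ (δ-no (v≉ ∘ u+v-w≈0⇒v≈w-u u v w))) (zeroʳ _))) (zeroʳ _)) ⟩
      k u (w F.- u) * ((q · 1#) * δ (u F.+ (w F.- u) F.- w))
        ≈⟨ *-congˡ (trans (*-congˡ (δ-yes (v≈w-u⇒u+v-w≈0 u _ w F.refl))) (*-identityʳ _)) ⟩
      k u (w F.- u) * (q · 1#)       ≈⟨ *-comm _ _ ⟩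
      (q · 1#) * k u (w F.- u)       ∎

  -- Self-duality in spectral form: two elements lie in the same class exactly if all eigenvalues
  -- agree at their multiples by κ. The factor κ admits a dual partition that is a dilate of the
  -- original one.
  module _
    (D-identity : ∀ x → D Fin.zero x ⇔ x F.≈ F.0#)
    (D-symmetric : ∀ i {x} → D i x → D i (F.- x))
    {κ : F.Carrier} (κ#0 : κ F.# F.0#)
    (eigenvalue-class : ∀ k {x y} → D k x → D k y → ∀ i → eigenvalue i (κ F.* x) ≈ eigenvalue i (κ F.* y))
    (eigenvalue-separates : ∀ k {x y} → D k x → (∀ i → eigenvalue i (κ F.* x) ≈ eigenvalue i (κ F.* y)) → D k y)
    where

    private
      κ⁻¹ : F.Carrier
      κ⁻¹ = proj₁ (F.inverse κ#0)

      κ⁻¹κ≈1 : κ⁻¹ F.* κ F.≈ F.1#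
      κ⁻¹κ≈1 = proj₂ (F.inverse κ#0)

      κκ⁻¹≈1 : κ F.* κ⁻¹ F.≈ F.1#
      κκ⁻¹≈1 = F.trans (F.*-comm _ _) κ⁻¹κ≈1

    -- The kernel ψ(κ z x) is symmetric in z and x. Read as a character in z, it turns the transform
    -- at x into a combination of eigenvalues at κ x, and these depend only on the class of x.
    transform-class : ∀ g → IsClassFunction g →
                      ∀ k {x y} → D k x → D k y →
                      ∑ (λ z → g z * ⟦ ψ[ κ F.* z ] ⟧ x) ≈ ∑ (λ z → g z * ⟦ ψ[ κ F.* z ] ⟧ y)
    transform-class g g-class k {x} {y} Dx Dy = begin
      ∑ (λ z → g z * ⟦ ψ[ κ F.* z ] ⟧ x)                              ≈⟨ by-classes x ⟩
      sum (λ l → g (representative l) * eigenvalue l (κ F.* x))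
        ≈⟨ SemiringSum.sum-cong-≋ semiring {suc d} (λ l → *-congˡ {g (representative l)} (eigenvalue-class k Dx Dy l)) ⟩
      sum (λ l → g (representative l) * eigenvalue l (κ F.* y))       ≈⟨ by-classes y ⟨
      ∑ (λ z → g z * ⟦ ψ[ κ F.* z ] ⟧ y)                              ∎
      where
      swap : ∀ x z → ⟦ ψ[ κ F.* z ] ⟧ x ≈ ⟦ ψ[ κ F.* x ] ⟧ z
      swap x z = ⟦⟧-cong ψ (F.trans (F.*-assoc _ _ _)
        (F.trans (F.*-congˡ (F.*-comm z x)) (F.sym (F.*-assoc _ _ _))))

      by-classes : ∀ x → ∑ (λ z → g z * ⟦ ψ[ κ F.* z ] ⟧ x) ≈
                   sum (λ l → g (representative l) * eigenvalue l (κ F.* x))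
      by-classes x = trans (∑-cong (λ z → *-congˡ (swap x z))) (transform-expansion g g-class (κ F.* x))

    -- Substituting κ z in the inversion formula makes the product of eigenvalues a class function
    -- of z, so that its transform is constant on classes. The argument there is -x, which stays in
    -- the class of x.
    convolution-class : ∀ i j k {x y} → D k x → D k y → convolution i j x ≈ convolution i j y
    convolution-class i j k {x} {y} Dx Dy = *-cancelˡ (#⇒≉ q#0) (begin
      (q · 1#) * convolution i j x                                   ≈⟨ scaled x ⟩
      ∑ (λ z → product z * ⟦ ψ[ κ F.* z ] ⟧ (F.- x))
        ≈⟨ transform-class product
             (λ k Dx Dy → *-cong (eigenvalue-class k Dx Dy i) (eigenvalue-class k Dx Dy j))
             k (D-symmetric k Dx) (D-symmetric k Dy) ⟩
      ∑ (λ z → product z * ⟦ ψ[ κ F.* z ] ⟧ (F.- y))                 ≈⟨ scaled y ⟨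
      (q · 1#) * convolution i j y                                   ∎)
      where
      product : F.Carrier → Carrier
      product z = eigenvalue i (κ F.* z) * eigenvalue j (κ F.* z)

      scaled : ∀ w → (q · 1#) * convolution i j w ≈ ∑ (λ z → product z * ⟦ ψ[ κ F.* z ] ⟧ (F.- w))
      scaled w = trans (convolution-eigenvalue i j w) (sym (∑-permute (dilation κ#0)
        (λ x → (eigenvalue i x * eigenvalue j x) * ⟦ ψ[ x ] ⟧ (F.- w))
        (λ x≈y → *-cong (*-cong (eigenvalue-cong i x≈y) (eigenvalue-cong j x≈y)) (ψ[]-cong x≈y _))))

    𝓡 : Fin (suc d) → Rel F.Carrier r
    𝓡 i x y = D i (x F.- y)

    𝓡-isPartition : IsPartition (F.setoid ×ₛ F.setoid) (λ i → uncurry (𝓡 i))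
    𝓡-isPartition = record
      { respects  = λ i (x≈x′ , y≈y′) → D.respects i (F.+-cong x≈x′ (F.-‿cong y≈y′))
      ; inhabited = λ i → (representative i , F.0#) , D.respects i (F.sym (F.x-0≈x _)) (representative∈ i)
      ; classify  = λ (x , y) → D.classify (x F.- y)
      }

    𝓡? : ∀ i x y → Dec (𝓡 i x y)
    𝓡? i x y = IsPartition.class? 𝓡-isPartition i (x , y)

    paths : (i j : Fin (suc d)) → F.Carrier → F.Carrier → ℕ
    paths i j x y = count (q , enum) (λ z → 𝓡? i x z ×-dec 𝓡? j z y)

    paths-convolution : ∀ i j x y → paths i j x y · 1# ≈ convolution i j (x F.- y)
    paths-convolution i j x y = begin
      paths i j x y · 1#                                      ≈⟨ count-select (λ z → 𝓡? i x z ×-dec 𝓡? j z y) ⟩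
      ∑ (λ z → indicator (𝓡? i x z ×-dec 𝓡? j z y))
        ≈⟨ ∑-cong (λ z → trans (indicator-× (𝓡? i x z) (𝓡? j z y))
             (*-cong (indicator-⇔ (𝓡? i x z) (D? i (x F.- z)) id id)
                     (indicator-⇔ (𝓡? j z y) (D? j (z F.- y)) id id))) ⟩
      ∑ step
        -- The substitution z = x - u turns the two conditions on z into u ∈ D_i and (x - y) - u ∈
        -- D_j.
        ≈⟨ ∑-permute (Composition.inverse negation (translation x)) step
             (λ z≈z′ → *-cong (1[]-cong i (F.+-congˡ (F.-‿cong z≈z′))) (1[]-cong j (F.+-congʳ z≈z′))) ⟨
      ∑ (λ u → step (F.- u F.+ x))
        ≈⟨ ∑-cong (λ u → *-cong (1[]-cong i (first u)) (1[]-cong j (second u))) ⟩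
      convolution i j (x F.- y)                               ∎
      where
      step : F.Carrier → Carrier
      step z = 1[ i ] (x F.- z) * 1[ j ] (z F.- y)

      first : ∀ u → x F.- (F.- u F.+ x) F.≈ u
      first u = F.trans (F.+-congˡ (F.trans (F.sym (F.-‿+-comm _ _)) (F.+-comm _ _)))
        (F.trans (F.sym (F.+-assoc _ _ _)) (F.trans (F.+-congʳ (F.-‿inverseʳ x))
          (F.trans (F.+-identityˡ _) (F.-‿involutive u))))

      second : ∀ u → (F.- u F.+ x) F.- y F.≈ (x F.- y) F.- u
      second u = F.trans (F.+-assoc _ _ _) (F.+-comm _ _)

    -- The counts are compared in K as values of a convolution, and characteristic zero brings the
    -- equality back to ℕ. The pair (`representative k`, 0) serves as base point of the class k.
    paths-regular : ∀ i j k {x y} → 𝓡 k x y → paths i j x y ≡ paths i j (representative k) F.0#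
    paths-regular i j k {x} {y} Rxy = ·1-injective _ _ (begin
      paths i j x y · 1#                             ≈⟨ paths-convolution i j x y ⟩
      convolution i j (x F.- y)
        ≈⟨ convolution-class i j k Rxy (D.respects k (F.sym (F.x-0≈x _)) (representative∈ k)) ⟩
      convolution i j (representative k F.- F.0#)    ≈⟨ paths-convolution i j _ _ ⟨
      paths i j (representative k) F.0# · 1#         ∎)
      where open RationalEmbedding K char0

    private
      y≈x+[y-x] : ∀ x y → y F.≈ x F.+ (y F.- x)
      y≈x+[y-x] x y = F.sym (F.trans (F.+-comm _ _) (F.trans (F.+-assoc _ _ _)
        (F.trans (F.+-congˡ (F.-‿inverseˡ x)) (F.+-identityʳ y))))

      -[x-y]≈y-x : ∀ x y → F.- (x F.- y) F.≈ y F.- x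
      -[x-y]≈y-x x y = F.trans (F.sym (F.-‿+-comm _ _)) (F.trans (F.+-comm _ _) (F.+-congʳ (F.-‿involutive y)))

      x-y≈-w : ∀ {x y w} → y F.≈ x F.+ w → x F.- y F.≈ F.- w
      x-y≈-w {x} {y} {w} y≈x+w = F.trans (F.+-congˡ (F.trans (F.-‿cong y≈x+w) (F.sym (F.-‿+-comm _ _))))
        (F.trans (F.sym (F.+-assoc _ _ _)) (F.trans (F.+-congʳ (F.-‿inverseʳ x)) (F.+-identityˡ _)))

      𝓡-symmetric : ∀ i {x y} → 𝓡 i x y → 𝓡 i y x
      𝓡-symmetric i Rxy = D.respects i (-[x-y]≈y-x _ _) (D-symmetric i Rxy)

    translationScheme : IsTranslationScheme F.+-abelianGroup D 𝓡
    translationScheme = record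
      { isPartition         = D-isPartition
      ; identity            = D-identity
      -- `𝓡` looks at x - y and a translation scheme at y - x; closure of the classes under negation
      -- reconciles the two.
      ; translation         = λ i x y → mk⇔
          (λ Rxy → y F.- x , 𝓡-symmetric i Rxy , y≈x+[y-x] x y)
          (λ (w , Dw , y≈x+w) → D.respects i (F.sym (x-y≈-w y≈x+w)) (D-symmetric i Dw))
      ; isAssociationScheme = record
        { finite             = q , enum
        ; isPartition        = 𝓡-isPartition
        ; diagonal           = λ x y → mk⇔
            (λ R₀ → F.x∙y⁻¹≈ε⇒x≈y x y (Equivalence.to (D-identity _) R₀))
            (λ x≈y → Equivalence.from (D-identity _) (F.x≈y⇒x∙y⁻¹≈ε x≈y))
        ; symmetric          = 𝓡-symmetric
        ; intersectionNumber = λ i j k → paths i j (representative k) F.0#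
        ; regular            = paths-regular
        }
      }

    characterSum-eigenvalue : ∀ {χ y} → χ Ĝ.≈ ψ[ y ] → ∀ i →
                              characterSum K translationScheme χ i ≈ eigenvalue i y
    characterSum-eigenvalue {χ} χ≈ψ i = trans (sumList-select (D? i) ⟦ χ ⟧) (∑-cong λ x → *-congˡ (χ≈ψ x))

    scaledCharacters : Inverse F.setoid Ĝ.setoid
    scaledCharacters = record
      { to        = λ x → ψ[ κ F.* x ]
      ; from      = λ χ → κ⁻¹ F.* index χ
      ; to-cong   = λ x≈y → ψ[]-cong (F.*-congˡ x≈y)
      ; from-cong = λ {χ} {χ′} χ≈χ′ → F.*-congˡ (ψ[]-injective
          (Ĝ.trans {ψ[ index χ ]} {χ} {ψ[ index χ′ ]} (index-ψ χ)
            (Ĝ.trans {χ} {χ′} {ψ[ index χ′ ]} χ≈χ′ (Ĝ.sym {ψ[ index χ′ ]} {χ′} (index-ψ χ′)))))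
      ; inverse   =
          (λ {χ} {x} x≈ → Ĝ.trans {ψ[ κ F.* x ]} {ψ[ index χ ]} {χ}
            (ψ[]-cong (F.trans (F.*-congˡ x≈) (F.*-cancel-inverse κκ⁻¹≈1 (index χ)))) (index-ψ χ))
        , (λ {x} {χ} χ≈ → F.trans
            (F.*-congˡ (ψ[]-injective (Ĝ.trans {ψ[ index χ ]} {χ} {ψ[ κ F.* x ]} (index-ψ χ) χ≈)))
            (F.*-cancel-inverse κ⁻¹κ≈1 x))
      }
      where
      index : Ĝ.Carrier → F.Carrier
      index χ = proj₁ (ψ[]-surjective χ)
      index-ψ : ∀ χ → ψ[ index χ ] Ĝ.≈ χ
      index-ψ χ = proj₂ (ψ[]-surjective χ)

    private
      module φ = Inverse scaledCharacters
      _∼′_ = _∼_ K translationScheme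

      ∼-eigenvalue : ∀ {χ χ′ x y} → χ Ĝ.≈ φ.to x → χ′ Ĝ.≈ φ.to y →
                     χ ∼′ χ′ ⇔ (∀ i → eigenvalue i (κ F.* x) ≈ eigenvalue i (κ F.* y))
      ∼-eigenvalue {χ} {χ′} χ≈ χ′≈ = mk⇔
        (λ χ∼χ′ i → trans (sym (characterSum-eigenvalue {χ} χ≈ i))
                      (trans (χ∼χ′ i) (characterSum-eigenvalue {χ′} χ′≈ i)))
        (λ eq i → trans (characterSum-eigenvalue {χ} χ≈ i)
                    (trans (eq i) (sym (characterSum-eigenvalue {χ′} χ′≈ i))))

    -- Defined by `∼` and not as the image of `D i`, since a dual partition has to live at the
    -- universe level of equality in K. `D⇔dualClass` identifies it with that image.
    dualClass : Fin (suc d) → Pred Ĝ.Carrier ℓ₃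
    dualClass i χ = χ ∼′ φ.to (representative i)

    dualClass⇒ : ∀ i {χ x} → χ Ĝ.≈ φ.to x → dualClass i χ → D i x
    dualClass⇒ i {χ} χ≈ χ∼ = eigenvalue-separates i (representative∈ i)
      (sym ∘ Equivalence.to (∼-eigenvalue {χ} {φ.to (representative i)} χ≈ (λ _ → refl)) χ∼)

    dualClass⇐ : ∀ i {χ x} → χ Ĝ.≈ φ.to x → D i x → dualClass i χ
    dualClass⇐ i {χ} χ≈ Dx = Equivalence.from (∼-eigenvalue {χ} {φ.to (representative i)} χ≈ (λ _ → refl))
      (eigenvalue-class i Dx (representative∈ i))

    D⇔dualClass : ∀ i x → D i x ⇔ dualClass i (φ.to x)
    D⇔dualClass i x = mk⇔ (dualClass⇐ i {φ.to x} (λ _ → refl)) (dualClass⇒ i {φ.to x} (λ _ → refl))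

    dualClass-isPartition : IsPartition Ĝ.setoid dualClass
    dualClass-isPartition = record
      { respects  = λ i {χ} {χ′} χ≈χ′ χ∼ → dualClass⇐ i {χ′} (preimage χ′)
          (dualClass⇒ i {χ} (Ĝ.trans {χ} {χ′} {φ.to (φ.from χ′)} χ≈χ′ (preimage χ′)) χ∼)
      ; inhabited = λ i → φ.to (representative i) , λ _ → refl
      ; classify  = λ χ → let i , Dx , unique = D.classify (φ.from χ) in
          i , dualClass⇐ i {χ} (preimage χ) Dx , λ {j} χ∼ → unique (dualClass⇒ j {χ} (preimage χ) χ∼)
      }
      where
      preimage : ∀ χ → χ Ĝ.≈ φ.to (φ.from χ)
      preimage χ = Ĝ.sym {φ.to (φ.from χ)} {χ} (φ.strictlyInverseˡ χ)

    isSelfDual : IsSelfDual K translationScheme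
    isSelfDual = record
      { D′              = dualClass
      ; isDualPartition = record
        { isPartition = dualClass-isPartition
        ; isClass     = λ i χ∼ χ′ → mk⇔
            (λ χ′∼ j → trans (χ∼ j) (sym (χ′∼ j)))
            (λ χ∼χ′ j → trans (sym (χ∼χ′ j)) (χ∼ j))
        }
      ; dualScheme      = translationScheme-transport F.+-abelianGroup Ĝ scaledCharacters scaled-homo
                            dualClass-isPartition D⇔dualClass translationScheme
      ; isomorphism     = record
        { points    = scaledCharacters
        ; classes   = Permutation.id
        ; preserves = translate-transport F.+-abelianGroup Ĝ scaledCharacters scaled-homo
                        dualClass-isPartition D⇔dualClass translationScheme
        }
      }
      where
      scaled-homo : ∀ x y → φ.to (x F.+ y) Ĝ.≈ (φ.to x Ĝ.∙ φ.to y)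
      scaled-homo x y z = trans (ψ[]-cong (F.distribˡ κ x y) z) (ψ[]-homo (κ F.* x) (κ F.* y) z)

-- Uniqueness of solutions of small linear systems

module LinearSystems (K : HeytingField a ℓ₁ ℓ₂) where
  open FieldOps K hiding (zero)
  open HeytingFieldProperties K
  open SetoidReasoning setoid
  private
    module Sum = SemiringSum semiring

  two-unknowns : ∀ {s t x y x′ y′} → ¬ s ≈ t → x + y ≈ x′ + y′ → s * x + t * y ≈ s * x′ + t * y′ →
                 x ≈ x′ × y ≈ y′
  two-unknowns {s} {t} {x} {y} {x′} {y′} s≉t sum≈ weighted≈ = x≈x′ , y≈y′
    where
    open Solver using (solve; _:+_; _:*_; _:=_)

    -- This is (s - t) (x - x′) = 0, obtained by eliminating y and y′ and rearranged without
    -- subtraction to suit the semiring solver.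
    crossed : s * x + t * x′ ≈ s * x′ + t * x
    crossed = +-cancelʳ (t * y + t * y′) _ _ (begin
      (s * x + t * x′) + (t * y + t * y′)    ≈⟨ solve 6 (λ s t x y x′ y′ →
          (s :* x :+ t :* x′) :+ (t :* y :+ t :* y′) := (s :* x :+ t :* y) :+ t :* (x′ :+ y′))
          refl s t x y x′ y′ ⟩
      (s * x + t * y) + t * (x′ + y′)        ≈⟨ +-cong weighted≈ (*-congˡ (sym sum≈)) ⟩
      (s * x′ + t * y′) + t * (x + y)        ≈⟨ solve 6 (λ s t x y x′ y′ →
          (s :* x′ :+ t :* y′) :+ t :* (x :+ y) := (s :* x′ :+ t :* x) :+ (t :* y :+ t :* y′))
          refl s t x y x′ y′ ⟩
      (s * x′ + t * x) + (t * y + t * y′)    ∎)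

    difference : ∀ {x x′} → s * x + t * x′ ≈ s * x′ + t * x → s * x - t * x ≈ s * x′ - t * x′
    difference {x} {x′} eq = +-cancelʳ (t * x + t * x′) _ _ (begin
      (s * x - t * x) + (t * x + t * x′)     ≈⟨ cancel (s * x) (t * x) (t * x′) ⟩
      s * x + t * x′                         ≈⟨ eq ⟩
      s * x′ + t * x                         ≈⟨ cancel (s * x′) (t * x′) (t * x) ⟨
      (s * x′ - t * x′) + (t * x′ + t * x)   ≈⟨ +-congˡ (+-comm _ _) ⟩
      (s * x′ - t * x′) + (t * x + t * x′)   ∎)
      where
      cancel : ∀ u v w → (u - v) + (v + w) ≈ u + w
      cancel u v w = trans (+-assoc _ _ _) (+-congˡ (trans (sym (+-assoc _ _ _))
        (trans (+-congʳ (-‿inverseˡ v)) (+-identityˡ w))))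

    x≈x′ : x ≈ x′
    x≈x′ = *-cancelˡ (s≉t ∘ x∙y⁻¹≈ε⇒x≈y s t) (begin
      (s - t) * x        ≈⟨ [y-z]x≈yx-zx x s t ⟩
      s * x - t * x      ≈⟨ difference crossed ⟩
      s * x′ - t * x′    ≈⟨ [y-z]x≈yx-zx x′ s t ⟨
      (s - t) * x′       ∎)

    y≈y′ : y ≈ y′
    y≈y′ = +-cancelˡ x y y′ (trans sum≈ (+-congʳ (sym x≈x′)))

  sum-removeAt : ∀ {n} (t t′ : Fin (suc n) → Carrier) i → t i ≈ t′ i → sum t ≈ sum t′ →
                 sum (t ∘ punchIn i) ≈ sum (t′ ∘ punchIn i)
  sum-removeAt t t′ i tᵢ≈t′ᵢ sum≈ = +-cancelˡ (t i) _ _ (begin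
    t i + sum (t ∘ punchIn i)      ≈⟨ Sum.sum-remove {i = i} t ⟨
    sum t                          ≈⟨ sum≈ ⟩
    sum t′                         ≈⟨ Sum.sum-remove {i = i} t′ ⟩
    t′ i + sum (t′ ∘ punchIn i)    ≈⟨ +-congʳ tᵢ≈t′ᵢ ⟨
    t i + sum (t′ ∘ punchIn i)     ∎)

  -- Removing the known entry i leaves two unknowns, indexed through `punchIn i`, with different
  -- weights.
  three-unknowns : ∀ (s t t′ : Fin 3 → Carrier) i → (∀ {j k} → s j ≈ s k → j ≡ k) → t i ≈ t′ i →
                   sum t ≈ sum t′ → sum (λ j → s j * t j) ≈ sum (λ j → s j * t′ j) → ∀ j → t j ≈ t′ j
  three-unknowns s t t′ i s-inj tᵢ≈t′ᵢ sum≈ weighted≈ j with i Fin.≟ j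
  ... | yes ≡.refl = tᵢ≈t′ᵢ
  ... | no i≢j = ≡.subst (λ j → t j ≈ t′ j) (Fin.punchIn-punchOut i≢j) (rest (Fin.punchOut i≢j))
    where
    x+[y+0]≈x+y : ∀ x y → x + (y + 0#) ≈ x + y
    x+[y+0]≈x+y x y = +-congˡ (+-identityʳ y)

    solution : t (punchIn i 0F) ≈ t′ (punchIn i 0F) × t (punchIn i 1F) ≈ t′ (punchIn i 1F)
    solution = two-unknowns
      (λ s≈s → Fin.0≢1+n (Fin.punchIn-injective i 0F 1F (s-inj s≈s)))
      (trans (sym (x+[y+0]≈x+y _ _)) (trans (sum-removeAt t t′ i tᵢ≈t′ᵢ sum≈) (x+[y+0]≈x+y _ _)))
      (trans (sym (x+[y+0]≈x+y _ _)) (trans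
        (sum-removeAt (λ j → s j * t j) (λ j → s j * t′ j) i (*-congˡ tᵢ≈t′ᵢ) weighted≈)
        (x+[y+0]≈x+y _ _)))

    rest : ∀ (j : Fin 2) → t (punchIn i j) ≈ t′ (punchIn i j)
    rest 0F = proj₁ solution
    rest 1F = proj₂ solution

-- Cyclotomic classes and Gauss periods

module CyclotomicClasses
  (F : HeytingField a ℓ₁ ℓ₂) {q : ℕ} (enum : Enumeration q (FieldOps.setoid F))
  {γ : HeytingField.Carrier F} (γ-primitive : IsPrimitiveElement F γ) {N : ℕ} (0<N : 0 < N)
  where
  open FieldOps F hiding (zero)
  open HeytingFieldProperties F
  open FiniteField F enum
  open SetoidReasoning setoid

  -- Definitionally Cyclotomy.C, which does not depend on the remaining parameters there.
  Class : ℕ → Pred Carrier ℓ₁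
  Class i x = ∃ λ (k : Fin q) → x ≈ γ ^ i * (γ ^ N) ^ toℕ k

  γ#0 : γ # 0#
  γ#0 = proj₁ γ-primitive

  γ^≉0 : ∀ n → ¬ γ ^ n ≈ 0#
  γ^≉0 n = ^-≉0 n (#⇒≉ γ#0)

  γ^#0 : ∀ n → γ ^ n # 0#
  γ^#0 n = ≉0⇒#0 (γ^≉0 n)

  -- The exponent in `Class` is bounded by q, so an arbitrary one is reduced modulo q - 1, where
  -- x^(q - 1) = 1 applies.
  Class-intro : ∀ i k {x} → x ≈ γ ^ i * (γ ^ N) ^ k → Class i x
  Class-intro i k {x} x≈ = fromℕ< k%<q , (begin
    x                                               ≈⟨ x≈ ⟩
    γ ^ i * (γ ^ N) ^ k                             ≈⟨ *-congˡ (^-mod k) ⟩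
    γ ^ i * (γ ^ N) ^ (k % (q ∸ 1))                 ≈⟨ *-congˡ (^-congʳ (γ ^ N) (Fin.toℕ-fromℕ< k%<q)) ⟨
    γ ^ i * (γ ^ N) ^ toℕ (fromℕ< k%<q)             ∎)
    where
    instance
      q-1≢0 : NonZero (q ∸ 1)
      q-1≢0 = ℕ.>-nonZero (ℕ.m<n⇒0<n∸m 1<q)
    k%<q : k % (q ∸ 1) < q
    k%<q = ℕ.<-≤-trans (m%n<n k (q ∸ 1)) (ℕ.m∸n≤m q 1)
    ^-mod : ∀ k → (γ ^ N) ^ k ≈ (γ ^ N) ^ (k % (q ∸ 1))
    ^-mod k = begin
      (γ ^ N) ^ k                                                        ≈⟨ ^-congʳ (γ ^ N) (m≡m%n+[m/n]*n k (q ∸ 1)) ⟩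
      (γ ^ N) ^ (k % (q ∸ 1) ℕ.+ k / (q ∸ 1) ℕ.* (q ∸ 1))                ≈⟨ ^-homo-* (γ ^ N) (k % (q ∸ 1)) _ ⟩
      (γ ^ N) ^ (k % (q ∸ 1)) * (γ ^ N) ^ (k / (q ∸ 1) ℕ.* (q ∸ 1))      ≈⟨ *-congˡ (^-congʳ (γ ^ N) (ℕ.*-comm (k / (q ∸ 1)) (q ∸ 1))) ⟩
      (γ ^ N) ^ (k % (q ∸ 1)) * (γ ^ N) ^ ((q ∸ 1) ℕ.* (k / (q ∸ 1)))    ≈⟨ *-congˡ (^-assocʳ (γ ^ N) (q ∸ 1) _) ⟨
      (γ ^ N) ^ (k % (q ∸ 1)) * ((γ ^ N) ^ (q ∸ 1)) ^ (k / (q ∸ 1))      ≈⟨ *-congˡ (^-congˡ (k / (q ∸ 1)) (x^[q-1]≈1 (γ^≉0 N))) ⟩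
      (γ ^ N) ^ (k % (q ∸ 1)) * 1# ^ (k / (q ∸ 1))                       ≈⟨ *-congˡ (1^ (k / (q ∸ 1))) ⟩
      (γ ^ N) ^ (k % (q ∸ 1)) * 1#                                       ≈⟨ *-identityʳ _ ⟩
      (γ ^ N) ^ (k % (q ∸ 1))                                            ∎

  Class-cong : ∀ i {x y} → x ≈ y → Class i x → Class i y
  Class-cong i x≈y (k , x≈) = k , trans (sym x≈y) x≈

  Class₀-power : ∀ {x} → Class 0 x → ∃ λ k → x ≈ (γ ^ N) ^ k
  Class₀-power (k , x≈) = toℕ k , trans x≈ (*-identityˡ _)

  power-Class₀ : ∀ k {x} → x ≈ (γ ^ N) ^ k → Class 0 x
  power-Class₀ k x≈ = Class-intro 0 k (trans x≈ (sym (*-identityˡ _)))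

  Class₀-* : ∀ {x y} → Class 0 x → Class 0 y → Class 0 (x * y)
  Class₀-* x∈ y∈ with k , x≈ ← Class₀-power x∈ | l , y≈ ← Class₀-power y∈ =
    power-Class₀ (k ℕ.+ l) (trans (*-cong x≈ y≈) (sym (^-homo-* (γ ^ N) k l)))

  Class₀-^ : ∀ {x} n → Class 0 x → Class 0 (x ^ n)
  Class₀-^ zero    x∈ = power-Class₀ 0 refl
  Class₀-^ (suc n) x∈ = Class₀-* x∈ (Class₀-^ n x∈)

  Class₀-≉0 : ∀ {x} → Class 0 x → ¬ x ≈ 0#
  Class₀-≉0 x∈ x≈0 with k , x≈ ← Class₀-power x∈ = ^-≉0 k (γ^≉0 N) (trans (sym x≈) x≈0)

  -- The inverse of x is its power x^(q - 2), which closure under products keeps in the class.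
  Class₀-cancel : ∀ {x y} → Class 0 x → Class 0 (x * y) → Class 0 y
  Class₀-cancel {x} {y} x∈ xy∈ = Class-cong 0 (*-cancel-inverse inv y) (Class₀-* (Class₀-^ (q ∸ 2) x∈) xy∈)
    where
    inv : x ^ (q ∸ 2) * x ≈ 1#
    inv = begin
      x ^ (q ∸ 2) * x  ≈⟨ *-comm _ _ ⟩
      x * x ^ (q ∸ 2)  ≈⟨ ^-congʳ x (≡.sym (ℕ.+-∸-assoc 1 1<q)) ⟩
      x ^ (q ∸ 1)      ≈⟨ x^[q-1]≈1 (Class₀-≉0 x∈) ⟩
      1#               ∎

  Class⇒coset : ∀ i {x} → Class i x → ∃ λ z → Class 0 z × x ≈ γ ^ i * z
  Class⇒coset i (k , x≈) = (γ ^ N) ^ toℕ k , power-Class₀ (toℕ k) refl , x≈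

  coset⇒Class : ∀ i {x} → Class 0 x → Class i (γ ^ i * x)
  coset⇒Class i x∈ with k , x≈ ← Class₀-power x∈ = Class-intro i k (*-congˡ x≈)

  Class-cancel : ∀ i {x} → Class i (γ ^ i * x) → Class 0 x
  Class-cancel i x∈ with z , z∈ , eq ← Class⇒coset i x∈ = Class-cong 0 (sym (*-cancelˡ (γ^≉0 i) eq)) z∈

  Class-≉0 : ∀ i {x} → Class i x → ¬ x ≈ 0#
  Class-≉0 i x∈ x≈0 with z , z∈ , eq ← Class⇒coset i x∈ =
    *-≉0 (γ^≉0 i) (Class₀-≉0 z∈) (trans (sym eq) x≈0)

  -- Division of the discrete logarithm by N: the remainder is the index of the class.
  ≉0⇒Class : ∀ {x} → ¬ x ≈ 0# → ∃ λ (j : Fin N) → Class (toℕ j) x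
  ≉0⇒Class {x} x≉0 with k , x≈γ^k ← proj₂ γ-primitive x (≉0⇒#0 x≉0) =
    fromℕ< k%N<N , Class-intro (toℕ (fromℕ< k%N<N)) (k / N) (begin
      x                                         ≈⟨ x≈γ^k ⟩
      γ ^ k                                     ≈⟨ ^-congʳ γ (m≡m%n+[m/n]*n k N) ⟩
      γ ^ (k % N ℕ.+ k / N ℕ.* N)               ≈⟨ ^-homo-* γ (k % N) _ ⟩
      γ ^ (k % N) * γ ^ (k / N ℕ.* N)
        ≈⟨ *-cong (^-congʳ γ (≡.sym (Fin.toℕ-fromℕ< k%N<N))) (^-congʳ γ (ℕ.*-comm (k / N) N)) ⟩
      γ ^ toℕ (fromℕ< k%N<N) * γ ^ (N ℕ.* (k / N))     ≈⟨ *-congˡ (^-assocʳ γ N (k / N)) ⟨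
      γ ^ toℕ (fromℕ< k%N<N) * (γ ^ N) ^ (k / N)       ∎)
    where
    instance
      N≢0 : NonZero N
      N≢0 = ℕ.>-nonZero 0<N
    k%N<N : k % N < N
    k%N<N = m%n<n k N

module GaussPeriods
  (F : HeytingField a ℓ₁ ℓ₂) {q : ℕ} (enum : Enumeration q (FieldOps.setoid F))
  (K : HeytingField b ℓ₃ ℓ₄) (char0 : CharacteristicZero K)
  {p f : ℕ} (p-prime : Prime p) (q≡p^f : q ≡ p ℕ.^ f)
  {ξ : HeytingField.Carrier K} (ξ-primitive : IsPrimitiveRootOfUnity K p ξ)
  {γ : HeytingField.Carrier F} (γ-primitive : IsPrimitiveElement F γ)
  {N : ℕ} (0<N : 0 < N)
  where
  private
    module F where
      open FieldOps F public
      open HeytingFieldProperties F public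
  open FieldOps K hiding (zero)
  open HeytingFieldProperties K
  open PrimePowerField F enum {p} {f} p-prime q≡p^f
  open CyclotomicClasses F enum γ-primitive 0<N
  open AdditiveCharacters F enum K char0
  open Cyclotomy F enum K char0 p f ξ γ N
  open SetoidReasoning setoid

  -- The trace is fixed by the Frobenius map and so lies in the prime field; the default value 0 of
  -- `residue` is never returned.
  residue-spec : ∀ x → residue x < p × (residue x F.· F.1#) F.≈ Tr x
  residue-spec x with Fin.any? {n = p} (λ n → (toℕ n F.· F.1#) ≟ Tr x)
  ... | yes (n , eq) = Fin.toℕ<n n , eq
  ... | no missing   = ⊥-elim (missing (x^p≈x⇒prime-field (trace^p≈trace x)))

  residue-cong : ∀ {x y} → x F.≈ y → residue x ≡ residue y
  residue-cong {x} {y} x≈y = ·1-injective (proj₁ (residue-spec x)) (proj₁ (residue-spec y))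
    (F.trans (proj₂ (residue-spec x)) (F.trans (trace-cong x≈y) (F.sym (proj₂ (residue-spec y)))))

  ξ^-cong-≤ : ∀ {m n} → m ≤ n → (m F.· F.1#) F.≈ (n F.· F.1#) → ξ ^ m ≈ ξ ^ n
  ξ^-cong-≤ {m} {n} m≤n eq with ·1≈⇒p∣∸ m≤n eq
  ... | divides k n∸m≡k*p = begin
    ξ ^ m                    ≈⟨ *-identityʳ _ ⟨
    ξ ^ m * 1#               ≈⟨ *-congˡ (trans (^-congˡ k (proj₁ ξ-primitive)) (1^ k)) ⟨
    ξ ^ m * (ξ ^ p) ^ k      ≈⟨ *-congˡ (^-assocʳ ξ p k) ⟩
    ξ ^ m * ξ ^ (p ℕ.* k)    ≈⟨ *-congˡ (^-congʳ ξ (≡.trans (ℕ.*-comm p k) (≡.sym n∸m≡k*p))) ⟩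
    ξ ^ m * ξ ^ (n ∸ m)      ≈⟨ ^-homo-* ξ m (n ∸ m) ⟨
    ξ ^ (m ℕ.+ (n ∸ m))      ≈⟨ ^-congʳ ξ (ℕ.m+[n∸m]≡n m≤n) ⟩
    ξ ^ n                    ∎

  ξ^-cong : ∀ m n → (m F.· F.1#) F.≈ (n F.· F.1#) → ξ ^ m ≈ ξ ^ n
  ξ^-cong m n eq with ℕ.≤-total m n
  ... | inj₁ m≤n = ξ^-cong-≤ m≤n eq
  ... | inj₂ n≤m = sym (ξ^-cong-≤ n≤m (F.sym eq))

  ψ-cong : ∀ {x y} → x F.≈ y → ψ x ≈ ψ y
  ψ-cong x≈y = ^-congʳ ξ (residue-cong x≈y)

  -- Residues add up only modulo p, which suffices because ξ^p = 1.
  ψ-homo : ∀ x y → ψ (x F.+ y) ≈ ψ x * ψ y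
  ψ-homo x y = trans
    (ξ^-cong (residue (x F.+ y)) (residue x ℕ.+ residue y)
      (F.trans (proj₂ (residue-spec (x F.+ y))) (F.trans (trace-+ x y) (F.sym
        (F.trans (F.×-homo-+ F.1# (residue x) (residue y))
          (F.+-cong (proj₂ (residue-spec x)) (proj₂ (residue-spec y))))))))
    (^-homo-* ξ (residue x) (residue y))

  ψ-0 : ψ F.0# ≈ 1#
  ψ-0 = ξ^-cong (residue F.0#) 0 (F.trans (proj₂ (residue-spec F.0#)) (F.+-cancelˡ (Tr F.0#) _ _ (F.trans
    (F.sym (trace-+ F.0# F.0#)) (F.trans (trace-cong (F.+-identityʳ F.0#)) (F.sym (F.+-identityʳ _))))))

  ψ-character : Character F.+-abelianGroup K
  ψ-character = record
    { ⟦_⟧ = ψ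
    ; isMonoidHomomorphism = record
      { isMagmaHomomorphism = record
        { isRelHomomorphism = record { cong = ψ-cong }
        ; homo = ψ-homo
        }
      ; ε-homo = ψ-0
      }
    }

  e : F.Carrier → Carrier
  e x = indicator (C? 0 x)

  e-cong : ∀ {x y} → x F.≈ y → e x ≈ e y
  e-cong x≈y = indicator-⇔ (C? 0 _) (C? 0 _) (Class-cong 0 x≈y) (Class-cong 0 (F.sym x≈y))

  -- The Fourier transform of the indicator of C₀. It extends the Gauss periods to all of F: its
  -- value is η_j on C_j and |C₀| at 0.
  period : F.Carrier → Carrier
  period x = ∑ (λ y → e y * ψ (x F.* y))

  period-cong : ∀ {x y} → x F.≈ y → period x ≈ period y
  period-cong x≈y = ∑-cong λ z → *-congˡ (ψ-cong (F.*-congʳ x≈y))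

  η≈period : ∀ j → η j ≈ period (γ F.^ toℕ j)
  η≈period j = begin
    η j                                    ≈⟨ sumList-select (C? (toℕ j)) ψ ⟩
    ∑ term                                 ≈⟨ ∑-permute (dilation (γ^#0 (toℕ j))) term term-cong ⟨
    ∑ (λ y → term (γ F.^ toℕ j F.* y))     ≈⟨ ∑-cong (λ y → *-congʳ (indicator-⇔ (C? (toℕ j) _) (C? 0 y)
                                                (Class-cancel (toℕ j)) (coset⇒Class (toℕ j)))) ⟩
    period (γ F.^ toℕ j)                   ∎
    where
    term : F.Carrier → Carrier
    term x = indicator (C? (toℕ j) x) * ψ x
    term-cong : ∀ {x y} → x F.≈ y → term x ≈ term y
    term-cong x≈y = *-cong
      (indicator-⇔ (C? (toℕ j) _) (C? (toℕ j) _) (Class-cong (toℕ j) x≈y) (Class-cong (toℕ j) (F.sym x≈y)))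
      (ψ-cong x≈y)

  -- Multiplication by z permutes C₀, the set over which the sum runs.
  period-coset : ∀ x {z} → C 0 z → period (x F.* z) ≈ period x
  period-coset x {z} z∈ = begin
    ∑ (λ y → e y * ψ (x F.* z F.* y))
      ≈⟨ ∑-cong (λ y → *-cong (indicator-⇔ (C? 0 y) (C? 0 _) (Class₀-* z∈) (Class₀-cancel z∈))
                              (ψ-cong (F.*-assoc x z y))) ⟩
    ∑ (λ y → e (z F.* y) * ψ (x F.* (z F.* y)))
      ≈⟨ ∑-permute (dilation (≉0⇒#0 (Class₀-≉0 z∈))) (λ y → e y * ψ (x F.* y))
           (λ y≈y′ → *-cong (e-cong y≈y′) (ψ-cong (F.*-congˡ y≈y′))) ⟩
    period x ∎

  period-class : ∀ j {x} → C (toℕ j) x → period x ≈ η j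
  period-class j {x} x∈ with z , z∈ , x≈ ← Class⇒coset (toℕ j) x∈ = begin
    period x                        ≈⟨ period-cong x≈ ⟩
    period (γ F.^ toℕ j F.* z)      ≈⟨ period-coset _ z∈ ⟩
    period (γ F.^ toℕ j)            ≈⟨ η≈period j ⟨
    η j                             ∎

  -- If ψ were trivial, then every period would equal the order of C₀.
  distinct-periods⇒nontrivial : ∀ i j → ¬ η i ≈ η j → ∃ λ x → ¬ ψ x ≈ 1#
  distinct-periods⇒nontrivial i j ηᵢ≉ηⱼ with Fin.any? (λ k → ¬? (residue (Inverse.to enum k) ℕ.≟ 0))
  -- The search is for a nonzero residue, a decidable property, unlike `ψ x ≈ 1#`. As ξ is
  -- primitive, an exponent strictly between 0 and p gives a power apart from 1.
  ... | yes (k , res≢0) = Inverse.to enum k , #⇒≉ (proj₂ ξ-primitive _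
                            (ℕ.n≢0⇒n>0 res≢0) (proj₁ (residue-spec (Inverse.to enum k))))
  ... | no none = ⊥-elim (ηᵢ≉ηⱼ (trans (constant i) (sym (constant j))))
    where
    ψ≈1 : ∀ x → ψ x ≈ 1#
    ψ≈1 x = trans (ψ-cong (F.sym (Inverse.strictlyInverseˡ enum x))) (^-congʳ ξ
      (decidable-stable (_ ℕ.≟ 0) (λ res≢0 → none (Inverse.from enum x , res≢0))))
    constant : ∀ j → η j ≈ ∑ e
    constant j = trans (η≈period j) (∑-cong λ y → trans (*-congˡ (ψ≈1 _)) (*-identityʳ _))

  module _
    (-1∈C₀ : C 0 (F.- F.1#))
    {α : Fin 3 → ℚ} (α-injective : ∀ {i j} → α i ≡ α j → i ≡ j)
    (values : PeriodsTakeExactlyTheValues α)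
    (i₀ : Fin 3) (i₀-unique : ∃! _≡_ (I α i₀))
    where
    private
      attained : ∀ j → ∃ λ i → I α i j
      attained = proj₁ values

      attains : ∀ i → ∃ λ j → I α i j
      attains = proj₂ values

      c : Fin N
      c = proj₁ i₀-unique

      c∈ : I α i₀ c
      c∈ = proj₁ (proj₂ i₀-unique)

      only-c : ∀ {j} → I α i₀ j → c ≡ j
      only-c = proj₂ (proj₂ i₀-unique)

      value : Fin 3 → Carrier
      value i = fromℚ K char0 (α i)

      value-injective : ∀ i j → value i ≈ value j → i ≡ j
      value-injective i j eq = α-injective (RationalEmbedding.fromℚ-injective K char0 eq)

      distinct : ¬ η (proj₁ (attains 0F)) ≈ η (proj₁ (attains 1F))
      distinct eq = Fin.0≢1+n (value-injective 0F 1F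
        (trans (sym (proj₂ (attains 0F))) (trans eq (proj₂ (attains 1F)))))

      nontrivial : ∃ λ x → ¬ ψ x ≈ 1#
      nontrivial = distinct-periods⇒nontrivial (proj₁ (attains 0F)) (proj₁ (attains 1F)) distinct

    -- With its converse below, this describes R₁, R₂, R₃ as the level sets of `period` on the
    -- nonzero elements.
    R-suc⇒ : ∀ i x → R α (Fin.suc i) x → ¬ x F.≈ F.0# × period x ≈ value i
    R-suc⇒ i x (j , Iij , x∈) = Class-≉0 (toℕ j) x∈ , trans (period-class j x∈) Iij

    R-suc⇐ : ∀ i x → ¬ x F.≈ F.0# → period x ≈ value i → R α (Fin.suc i) x
    R-suc⇐ i x x≉0 eq = let j , x∈ = ≉0⇒Class x≉0 in j , trans (sym (period-class j x∈)) eq , x∈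

    R-cong : ∀ i {x y} → x F.≈ y → R α i x → R α i y
    R-cong Fin.zero    x≈y (lift x≈0)      = lift (F.trans (F.sym x≈y) x≈0)
    R-cong (Fin.suc i) x≈y (j , Iij , x∈)  = j , Iij , Class-cong (toℕ j) x≈y x∈

    R-unique : ∀ i j x → R α i x → R α j x → i ≡ j
    R-unique Fin.zero    Fin.zero    x _          _          = ≡.refl
    R-unique Fin.zero    (Fin.suc j) x (lift x≈0) Rx         = ⊥-elim (proj₁ (R-suc⇒ j x Rx) x≈0)
    R-unique (Fin.suc i) Fin.zero    x Rx         (lift x≈0) = ⊥-elim (proj₁ (R-suc⇒ i x Rx) x≈0)
    R-unique (Fin.suc i) (Fin.suc j) x Rx         Rx′        = ≡.cong Fin.suc (value-injective i j
      (trans (sym (proj₂ (R-suc⇒ i x Rx))) (proj₂ (R-suc⇒ j x Rx′))))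

    R-covers : ∀ x → ∃ λ i → R α i x
    R-covers x = case x ≟ F.0# of λ where
      (yes x≈0) → Fin.zero , lift x≈0
      (no x≉0)  → let j , x∈ = ≉0⇒Class x≉0; i , Iij = attained j in Fin.suc i , j , Iij , x∈

    R-isPartition : IsPartition F.setoid (R α)
    R-isPartition = record
      { respects  = R-cong
      ; inhabited = λ where
          Fin.zero    → F.0# , lift F.refl
          (Fin.suc i) → let j , Iij = attains i in
            γ F.^ toℕ j , j , Iij , Class-intro (toℕ j) 0 (F.sym (F.*-identityʳ _))
      ; classify  = λ x → let i , Rx = R-covers x in i , Rx , λ {j} Rx′ → R-unique i j x Rx Rx′
      }

    R-identity : ∀ x → R α Fin.zero x ⇔ x F.≈ F.0#
    R-identity x = mk⇔ (λ (lift x≈0) → x≈0) lift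

    private
      x*-1≈-x : ∀ x → x F.* F.- F.1# F.≈ F.- x
      x*-1≈-x x = F.trans (F.*-comm _ _) (F.-1*x≈-x x)

      -x≈0⇒x≈0 : ∀ {x} → F.- x F.≈ F.0# → x F.≈ F.0#
      -x≈0⇒x≈0 -x≈0 = F.trans (F.sym (F.-‿involutive _)) (F.trans (F.-‿cong -x≈0) F.-0#≈0#)

    -- -x is x times an element of C₀ and so has the same period.
    R-symmetric : ∀ i {x} → R α i x → R α i (F.- x)
    R-symmetric Fin.zero    (lift x≈0) = lift (F.trans (F.-‿cong x≈0) F.-0#≈0#)
    R-symmetric (Fin.suc i) {x} Rx = R-suc⇐ i (F.- x) (proj₁ (R-suc⇒ i x Rx) ∘ -x≈0⇒x≈0)
      (trans (period-cong (F.sym (x*-1≈-x x))) (trans (period-coset x -1∈C₀) (proj₂ (R-suc⇒ i x Rx))))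

    e-neg : ∀ x → e (F.- x) ≈ e x
    e-neg x = indicator-⇔ (C? 0 (F.- x)) (C? 0 x)
      (λ -x∈ → Class₀-cancel -1∈C₀ (Class-cong 0 (F.sym (F.-1*x≈-x x)) -x∈))
      (λ x∈ → Class-cong 0 (F.-1*x≈-x x) (Class₀-* -1∈C₀ x∈))

    open Fourier ψ-character nontrivial
    open SelfDualPartition F enum K char0 ψ-character nontrivial R-isPartition

    period-isClassFunction : IsClassFunction period
    period-isClassFunction Fin.zero    (lift x≈0) (lift y≈0) = period-cong (F.trans x≈0 (F.sym y≈0))
    period-isClassFunction (Fin.suc i) {x} {y} Rx Ry = trans (proj₂ (R-suc⇒ i x Rx)) (sym (proj₂ (R-suc⇒ i y Ry)))

    -- Transforming the indicator `e` twice gives q times its value at -y, and -1 ∈ C₀ makes `e`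
    -- even.
    period-transform : ∀ y → ∑ (λ x → period x * ψ (y F.* x)) ≈ e y * (q · 1#)
    period-transform y = begin
      ∑ (λ x → period x * ψ (y F.* x))
        ≈⟨ ∑-cong (λ x → trans (*-distribʳ-∑ _ _) (∑-cong (λ z → combine x z))) ⟩
      ∑ (λ x → ∑ (λ z → e z * ψ ((z F.+ y) F.* x)))
        ≈⟨ ∑-comm _ ⟩
      ∑ (λ z → ∑ (λ x → e z * ψ ((z F.+ y) F.* x)))
        ≈⟨ ∑-cong (λ z → trans (sym (*-distribˡ-∑ _ _)) (*-congˡ (orthogonality (z F.+ y)))) ⟩
      ∑ (λ z → e z * ((q · 1#) * δ (z F.+ y)))
        ≈⟨ ∑-single _ (F.- y)
             (λ z≈z′ → *-cong (e-cong z≈z′) (*-congˡ (δ-cong (F.+-congʳ z≈z′))))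
             (λ z z≉-y → trans (*-congˡ (trans (*-congˡ (δ-no (z≉-y ∘ F.+-inverseˡ-unique z y))) (zeroʳ _))) (zeroʳ _)) ⟩
      e (F.- y) * ((q · 1#) * δ (F.- y F.+ y))
        ≈⟨ *-cong (e-neg y) (trans (*-congˡ (δ-yes (F.-‿inverseˡ y))) (*-identityʳ _)) ⟩
      e y * (q · 1#) ∎
      where
      combine : ∀ x z → (e z * ψ (x F.* z)) * ψ (y F.* x) ≈ e z * ψ ((z F.+ y) F.* x)
      combine x z = trans (*-assoc _ _ _) (*-congˡ (trans (sym (ψ-homo _ _))
        (ψ-cong (F.trans (F.+-congʳ (F.*-comm x z)) (F.sym (F.distribʳ x z y))))))

    -- The dual class of ψ[ y ] is the class of γ^c y; multiplication by κ undoes this shift.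
    private
      κ : F.Carrier
      κ = proj₁ (F.inverse (γ^#0 (toℕ c)))

      κγ^c≈1 : κ F.* γ F.^ toℕ c F.≈ F.1#
      κγ^c≈1 = proj₂ (F.inverse (γ^#0 (toℕ c)))

      κ#0 : κ F.# F.0#
      κ#0 = F.invertible⇒#0 (F.trans (F.*-comm _ _) κγ^c≈1)

      κx≈0⇒x≈0 : ∀ {x} → κ F.* x F.≈ F.0# → x F.≈ F.0#
      κx≈0⇒x≈0 eq = F.*-cancelˡ-# κ#0 (F.trans eq (F.sym (F.zeroʳ κ)))

      γ^cκx≈x : ∀ x → γ F.^ toℕ c F.* (κ F.* x) F.≈ x
      γ^cκx≈x = F.*-cancel-inverse (F.trans (F.*-comm _ _) κγ^c≈1)

      R-i₀⇒C : ∀ {x} → R α (Fin.suc i₀) x → C (toℕ c) x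
      R-i₀⇒C {x} (j , Ij , x∈) = ≡.subst (λ k → C (toℕ k) x) (≡.sym (only-c {j} Ij)) x∈

    -- The singleton hypothesis enters here: the class is the single coset γ^c C₀, so that its
    -- indicator is a dilate of `e`, with κ = γ^-c.
    e-κ : ∀ x → e (κ F.* x) ≈ 1[ Fin.suc i₀ ] x
    e-κ x = indicator-⇔ (C? 0 (κ F.* x)) (D? (Fin.suc i₀) x)
      (λ κx∈ → c , c∈ , Class-cong (toℕ c) (γ^cκx≈x x) (coset⇒Class (toℕ c) κx∈))
      (λ Rx → Class-cancel (toℕ c) (Class-cong (toℕ c) (F.sym (γ^cκx≈x x)) (R-i₀⇒C Rx)))

    -- Substituting κ y for y moves the dilation from the class to the argument. The right-hand side
    -- is constant on each R_i, which explains the choice of κ.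
    eigenvalue-i₀ : ∀ x → eigenvalue (Fin.suc i₀) (κ F.* x) ≈ period x
    eigenvalue-i₀ x = begin
      ∑ (λ y → 1[ Fin.suc i₀ ] y * ψ (κ F.* x F.* y))
        ≈⟨ ∑-cong (λ y → *-cong (sym (e-κ y)) (ψ-cong (F.trans (F.*-congʳ (F.*-comm κ x)) (F.*-assoc x κ y)))) ⟩
      ∑ (λ y → e (κ F.* y) * ψ (x F.* (κ F.* y)))
        ≈⟨ ∑-permute (dilation κ#0) (λ y → e y * ψ (x F.* y))
             (λ y≈y′ → *-cong (e-cong y≈y′) (ψ-cong (F.*-congˡ y≈y′))) ⟩
      period x ∎

    eigenvalue-0 : ∀ x → eigenvalue Fin.zero x ≈ 1#
    eigenvalue-0 x = begin
      ∑ (λ y → 1[ Fin.zero ] y * ψ (x F.* y))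
        ≈⟨ ∑-single _ F.0# (λ y≈y′ → *-cong (1[]-cong Fin.zero y≈y′) (ψ-cong (F.*-congˡ y≈y′)))
             (λ y y≉0 → trans (*-congʳ (indicator-no (D? Fin.zero y) (λ (lift y≈0) → y≉0 y≈0))) (zeroˡ _)) ⟩
      1[ Fin.zero ] F.0# * ψ (x F.* F.0#)
        ≈⟨ *-cong (indicator-yes (D? Fin.zero F.0#) (lift F.refl)) (trans (ψ-cong (F.zeroʳ x)) ψ-0) ⟩
      1# * 1#  ≈⟨ *-identityˡ _ ⟩
      1#       ∎

    sum-eigenvalues : ∀ y → sum (λ l → eigenvalue l y) ≈ (q · 1#) * δ y
    sum-eigenvalues y = begin
      sum (λ l → eigenvalue l y)        ≈⟨ Sum.sum-cong-≋ {4} (λ l → *-identityˡ (eigenvalue l y)) ⟨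
      sum (λ l → 1# * eigenvalue l y)   ≈⟨ transform-expansion (λ _ → 1#) (λ _ _ _ → refl) y ⟨
      ∑ (λ x → 1# * ψ (y F.* x))        ≈⟨ ∑-cong (λ x → *-identityˡ _) ⟩
      ∑ (λ x → ψ (y F.* x))             ≈⟨ orthogonality y ⟩
      (q · 1#) * δ y                    ∎
      where module Sum = SemiringSum semiring

    -- The weights are α₁, α₂, α₃ on the three classes and |C₀| on the class of 0, since they are
    -- the values of `period`.
    weighted-eigenvalues : ∀ y → sum (λ l → period (representative l) * eigenvalue l y) ≈ e y * (q · 1#)
    weighted-eigenvalues y = trans (sym (transform-expansion period period-isClassFunction y)) (period-transform y)

    eigenvalue-class : ∀ k {x y} → R α k x → R α k y → ∀ i → eigenvalue i (κ F.* x) ≈ eigenvalue i (κ F.* y)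
    eigenvalue-class k {x} {y} Rx Ry Fin.zero = trans (eigenvalue-0 _) (sym (eigenvalue-0 _))
    eigenvalue-class k {x} {y} Rx Ry (Fin.suc i) = three-unknowns
      (λ j → period (representative (Fin.suc j)))
      (λ j → eigenvalue (Fin.suc j) (κ F.* x)) (λ j → eigenvalue (Fin.suc j) (κ F.* y)) i₀
      (λ {j} {j′} eq → value-injective j j′ (trans (sym (period-representative j)) (trans eq (period-representative j′))))
      (trans (eigenvalue-i₀ x) (trans (period-isClassFunction k Rx Ry) (sym (eigenvalue-i₀ y))))
      -- The class of 0 has eigenvalue 1 everywhere; it is removed from both relations, which leaves
      -- two equations in the three remaining eigenvalues.
      (sum-removeAt (λ l → eigenvalue l (κ F.* x)) (λ l → eigenvalue l (κ F.* y)) Fin.zero ev₀ (begin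
        sum (λ l → eigenvalue l (κ F.* x))    ≈⟨ sum-eigenvalues (κ F.* x) ⟩
        (q · 1#) * δ (κ F.* x)                ≈⟨ *-congˡ δ≈δ ⟩
        (q · 1#) * δ (κ F.* y)                ≈⟨ sum-eigenvalues (κ F.* y) ⟨
        sum (λ l → eigenvalue l (κ F.* y))    ∎))
      (sum-removeAt (λ l → period (representative l) * eigenvalue l (κ F.* x))
                    (λ l → period (representative l) * eigenvalue l (κ F.* y)) Fin.zero (*-congˡ ev₀) (begin
        sum (λ l → period (representative l) * eigenvalue l (κ F.* x))   ≈⟨ weighted-eigenvalues (κ F.* x) ⟩
        e (κ F.* x) * (q · 1#)
          ≈⟨ *-congʳ (trans (e-κ x) (trans (1[]-class (Fin.suc i₀) k Rx Ry) (sym (e-κ y)))) ⟩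
        e (κ F.* y) * (q · 1#)                                           ≈⟨ weighted-eigenvalues (κ F.* y) ⟨
        sum (λ l → period (representative l) * eigenvalue l (κ F.* y))   ∎))
      i
      where
      open LinearSystems K

      period-representative : ∀ j → period (representative (Fin.suc j)) ≈ value j
      period-representative j = proj₂ (R-suc⇒ j (representative (Fin.suc j)) (representative∈ (Fin.suc j)))

      ev₀ : eigenvalue Fin.zero (κ F.* x) ≈ eigenvalue Fin.zero (κ F.* y)
      ev₀ = trans (eigenvalue-0 _) (sym (eigenvalue-0 _))

      zero-class : ∀ {x y} → R α k x → R α k y → κ F.* x F.≈ F.0# → κ F.* y F.≈ F.0#
      zero-class {x} {y} Rx Ry κx≈0 = F.trans
        (F.*-congˡ (Equivalence.to (R-identity y) (≡.subst (λ l → R α l y)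
          (R-unique k Fin.zero x Rx (lift (κx≈0⇒x≈0 κx≈0))) Ry)))
        (F.zeroʳ κ)

      δ≈δ : δ (κ F.* x) ≈ δ (κ F.* y)
      δ≈δ = indicator-⇔ (κ F.* x ≟ F.0#) (κ F.* y ≟ F.0#) (zero-class Rx Ry) (zero-class Ry Rx)

    -- Two invariants suffice: the sum of all eigenvalues detects x = 0, and the eigenvalue of the
    -- distinguished class is the period of x, which determines the class of a nonzero x.
    eigenvalue-separates : ∀ k {x y} → R α k x →
                           (∀ i → eigenvalue i (κ F.* x) ≈ eigenvalue i (κ F.* y)) → R α k y
    eigenvalue-separates k {x} {y} Rx eq = helper k Rx
      where
      δ≈δ : δ (κ F.* x) ≈ δ (κ F.* y)
      δ≈δ = *-cancelˡ-# q#0 (begin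
        (q · 1#) * δ (κ F.* x)                ≈⟨ sum-eigenvalues (κ F.* x) ⟨
        sum (λ l → eigenvalue l (κ F.* x))    ≈⟨ SemiringSum.sum-cong-≋ semiring {4} eq ⟩
        sum (λ l → eigenvalue l (κ F.* y))    ≈⟨ sum-eigenvalues (κ F.* y) ⟩
        (q · 1#) * δ (κ F.* y)                ∎)

      δ-reflects : ∀ {x y} → δ (κ F.* x) ≈ δ (κ F.* y) → x F.≈ F.0# → y F.≈ F.0#
      δ-reflects {x} {y} δ≈ x≈0 = F.≈-stable λ y≉0 → #⇒≉ 1#0 (begin
        1#             ≈⟨ δ-yes (F.trans (F.*-congˡ x≈0) (F.zeroʳ κ)) ⟨
        δ (κ F.* x)    ≈⟨ δ≈ ⟩
        δ (κ F.* y)    ≈⟨ δ-no (y≉0 ∘ κx≈0⇒x≈0) ⟩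
        0#             ∎)

      helper : ∀ k → R α k x → R α k y
      helper Fin.zero    (lift x≈0) = lift (δ-reflects δ≈δ x≈0)
      helper (Fin.suc i) Rx = R-suc⇐ i y (proj₁ (R-suc⇒ i x Rx) ∘ δ-reflects (sym δ≈δ)) (begin
        period y                               ≈⟨ eigenvalue-i₀ y ⟨
        eigenvalue (Fin.suc i₀) (κ F.* y)      ≈⟨ eq (Fin.suc i₀) ⟨
        eigenvalue (Fin.suc i₀) (κ F.* x)      ≈⟨ eigenvalue-i₀ x ⟩
        period x                               ≈⟨ proj₂ (R-suc⇒ i x Rx) ⟩
        value i                                ∎)

    selfDualScheme : Σ (IsTranslationScheme F.+-abelianGroup (R α) (Cyclotomy.𝓡 F enum K char0 p f ξ γ N α))
                       (IsSelfDual K)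
    selfDualScheme = translationScheme R-identity R-symmetric κ#0 eigenvalue-class eigenvalue-separates
                   , isSelfDual R-identity R-symmetric κ#0 eigenvalue-class eigenvalue-separates

-- Distinctness of the three values, and the theorem

increasing⇒injective : (α : Fin 3 → ℚ) → α 0F ℚ.< α 1F → α 1F ℚ.< α 2F → ∀ {i j} → α i ≡ α j → i ≡ j
increasing⇒injective α α₀<α₁ α₁<α₂ = injective _ _
  where
  injective : ∀ i j → α i ≡ α j → i ≡ j
  injective 0F 0F _  = ≡.refl
  injective 1F 1F _  = ≡.refl
  injective 2F 2F _  = ≡.refl
  injective 0F 1F eq = ⊥-elim (ℚ.<-irrefl eq α₀<α₁)
  injective 1F 0F eq = ⊥-elim (ℚ.<-irrefl (≡.sym eq) α₀<α₁)
  injective 1F 2F eq = ⊥-elim (ℚ.<-irrefl eq α₁<α₂)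
  injective 2F 1F eq = ⊥-elim (ℚ.<-irrefl (≡.sym eq) α₁<α₂)
  injective 0F 2F eq = ⊥-elim (ℚ.<-irrefl eq (ℚ.<-trans α₀<α₁ α₁<α₂))
  injective 2F 0F eq = ⊥-elim (ℚ.<-irrefl (≡.sym eq) (ℚ.<-trans α₀<α₁ α₁<α₂))

x-y<0⇒x<y : ∀ x y → x ℚ.- y ℚ.< 0ℚ → x ℚ.< y
x-y<0⇒x<y x y x-y<0 = ≡.subst₂ ℚ._<_
  (≡.trans (ℚ.+-assoc x (ℚ.- y) y) (≡.trans (≡.cong (x ℚ.+_) (ℚ.+-inverseˡ y)) (ℚ.+-identityʳ x)))
  (ℚ.+-identityˡ y)
  (ℚ.+-monoˡ-< y x-y<0)

0<x-y⇒y<x : ∀ x y → 0ℚ ℚ.< x ℚ.- y → y ℚ.< x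
0<x-y⇒y<x x y 0<x-y = ≡.subst₂ ℚ._<_
  (ℚ.+-identityˡ y)
  (≡.trans (ℚ.+-assoc x (ℚ.- y) y) (≡.trans (≡.cong (x ℚ.+_) (ℚ.+-inverseˡ y)) (ℚ.+-identityʳ x)))
  (ℚ.+-monoˡ-< y 0<x-y)

open import Data.Nat.Base using (_^_)

theorem2p7 : ∀ {a ℓ₁ ℓ₂ b ℓ₃ ℓ₄}
    (p f q N : ℕ) → Prime p → 0 < f → q ≡ p ^ f → 2 < N → N ∣ q ∸ 1 →
    (F : HeytingField a ℓ₁ ℓ₂) (enum : Enumeration q (FieldOps.setoid F)) →
    (K : HeytingField b ℓ₃ ℓ₄) (char0 : CharacteristicZero K) →
    (ξ : HeytingField.Carrier K) → IsPrimitiveRootOfUnity K p ξ →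
    (γ : HeytingField.Carrier F) → IsPrimitiveElement F γ →
    let module F = FieldOps F
        open Cyclotomy F enum K char0 p f ξ γ N
    in
    C 0 (F.- F.1#) →
    (α : Fin 3 → ℚ) → PeriodsTakeExactlyTheValues α →
    (t u v : ℚ) → 0ℚ ℚ.< t →
    α 0F ℚ.- α 1F ≡ ℚ.- (t ℚ.* u) → ℚ.- (t ℚ.* u) ℚ.< 0ℚ →
    α 2F ℚ.- α 1F ≡ t ℚ.* v → 0ℚ ℚ.< t ℚ.* v →
    ∃! _≡_ (I α 0F) ⊎ ∃! _≡_ (I α 2F) →
    Σ (IsTranslationScheme F.+-abelianGroup (R α) (𝓡 α)) (IsSelfDual K)
theorem2p7 p f q N p-prime _ q≡p^f 2<N _ F enum K char0 ξ ξ-primitive γ γ-primitive -1∈C₀ α values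
  t u v _ α₀-α₁≡-tu -tu<0 α₂-α₁≡tv 0<tv = λ where
    (inj₁ unique) → selfDualScheme -1∈C₀ α-injective values 0F unique
    (inj₂ unique) → selfDualScheme -1∈C₀ α-injective values 2F unique
  where
  open GaussPeriods F enum K char0 {p} {f} p-prime q≡p^f ξ-primitive γ-primitive (ℕ.<-trans (s≤s z≤n) 2<N)
  α-injective = increasing⇒injective α
    (x-y<0⇒x<y (α 0F) (α 1F) (≡.subst (ℚ._< 0ℚ) (≡.sym α₀-α₁≡-tu) -tu<0))
    (0<x-y⇒y<x (α 2F) (α 1F) (≡.subst (0ℚ ℚ.<_) (≡.sym α₂-α₁≡tv) 0<tv))
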